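{- There is an algorithm running in time polynomial in $n$ which, given two compatible strings $X,Y$ of length $n$ with all symbols drawn from $\{0,1,\dots,n-1\}$, computes two compatible binary strings $x,y$ of length polynomial in $n$ such that $D(X,Y)=d(x,y)$.
   Context: The prefix reversal (flip) $f^{(i)}$ applied to a string $s=s_1\cdots s_m$ ($1\le i\le m$) yields $s_i s_{i-1}\cdots s_1 s_{i+1}\cdots s_m$. Two strings are \emph{compatible} if each symbol occurs the same number of times in both. For compatible strings $X,Y$ over an arbitrary alphabet (symbols may repeat), $D(X,Y)$ denotes the minimum number of prefix reversals transforming $X$ into $Y$; for compatible binary strings $x,y$ (words over $\{0,1\}$) this minimum is denoted $d(x,y)$. -}

module Defs where

open import Data.Nat using (ℕ; suc; _+_; _*_; _^_; _≤_)
open import Data.Fin using (Fin; toℕ; _≟_)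
open import Data.Fin.Patterns using (0F; 1F)
open import Data.List using (List; []; _∷_; _++_; [_]; length; take; drop; reverse; replicate; concatMap; filter)
open import Data.Vec using (Vec; []; _∷_; lookup; _[_]≔_)
import Data.Vec as Vec
open import Data.Product using (_×_; ∃-syntax)
open import Relation.Binary.PropositionalEquality using (_≡_)

-- Strings over the alphabet {0, …, a-1}; binary strings are the case a = 2.
String : ℕ → Set
String a = List (Fin a)

Bit : Set
Bit = Fin 2

count : ∀ {a} → Fin a → String a → ℕ
count c s = length (filter (c ≟_) s)

Compatible : ∀ {a} → String a → String a → Set
Compatible {a} s t = (c : Fin a) → count c s ≡ count c t

-- Meaningful for 1 ≤ i ≤ length s, which is imposed in Flips.
prefixReversal : ∀ {a} → ℕ → String a → String a
prefixReversal i s = reverse (take i s) ++ drop i s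

-- Flips k s t: some sequence of exactly k prefix reversals transforms s into t.
data Flips {a : ℕ} : ℕ → String a → String a → Set where
  done : ∀ {s} → Flips 0 s s
  step : ∀ {k s t} (i : ℕ) → 1 ≤ i → i ≤ length s →
         Flips k (prefixReversal i s) t → Flips (suc k) s t

-- IsDistance s t k: the minimum number of prefix reversals transforming s
-- into t exists and equals k.  This is D(s,t) = k, and d(s,t) = k when a = 2.
IsDistance : ∀ {a} → String a → String a → ℕ → Set
IsDistance s t k = Flips k s t × (∀ j → Flips j s t → k ≤ j)

-- Model of computation: structured programs on a fixed number k of stacks of
-- bits.  Each stack operation and each test costs one time unit.  Control is
-- finite and a Turing machine tape is a pair of stacks, so this model and
-- multitape Turing machines simulate each other with polynomial overhead.
data Program (k : ℕ) : Set where
  skip  : Program k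
  push  : Fin k → Bit → Program k
  -- pop i p q: if stack i is empty run p; otherwise remove its top bit b
  -- and run q b.
  pop   : Fin k → Program k → (Bit → Program k) → Program k
  _⨾_   : Program k → Program k → Program k
  -- while i p: repeat p as long as stack i is nonempty.
  while : Fin k → Program k → Program k

infixr 5 _⨾_

-- The head of each list is the top of the stack.
Store : ℕ → Set
Store k = Vec (List Bit) k

-- Runs p σ t τ: started in σ, program p halts in τ after t time units.
data Runs {k : ℕ} : Program k → Store k → ℕ → Store k → Set where
  skip       : ∀ {σ} → Runs skip σ 1 σ
  push       : ∀ {σ i b} → Runs (push i b) σ 1 (σ [ i ]≔ (b ∷ lookup σ i))
  pop-empty  : ∀ {σ τ i p q t} → lookup σ i ≡ [] →
               Runs p σ t τ → Runs (pop i p q) σ (suc t) τ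
  pop-bit    : ∀ {σ τ i p q t b bs} → lookup σ i ≡ b ∷ bs →
               Runs (q b) (σ [ i ]≔ bs) t τ → Runs (pop i p q) σ (suc t) τ
  seq        : ∀ {σ ρ τ p q t u} →
               Runs p σ t ρ → Runs q ρ u τ → Runs (p ⨾ q) σ (t + u) τ
  while-done : ∀ {σ i p} → lookup σ i ≡ [] → Runs (while i p) σ 1 σ
  while-step : ∀ {σ ρ τ i p t u b bs} → lookup σ i ≡ b ∷ bs →
               Runs p σ t ρ → Runs (while i p) ρ u τ →
               Runs (while i p) σ (suc (t + u)) τ

-- Each symbol c is written as 1ᶜ0.  A string of length n over {0, …, n-1} has
-- a code of length at most n², so "polynomial in n" means the same here as
-- with symbols written in binary.
encode : ∀ {a} → String a → List Bit
encode = concatMap (λ c → replicate (toℕ c) 1F ++ [ 0F ])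

-- On input X, Y (coded on the first two stacks, the others empty) the program
-- halts after t time units with x and y on the first two stacks, uncoded.
-- The other stacks are workspace and may be left in any state.
Computes : ∀ {r a} → Program (2 + r) → (X Y : String a) → (x y : String 2) → ℕ → Set
Computes {r} P X Y x y t =
  ∃[ rest ] Runs P (encode X ∷ encode Y ∷ Vec.replicate r []) t (x ∷ y ∷ rest)

PolynomiallyBounded : (ℕ → ℕ) → Set
PolynomiallyBounded f = ∃[ c ] ∃[ e ] (∀ n → f n ≤ c * n ^ e + c)

{-# OPTIONS --safe #-}

-- A symbol c is encoded by M ≥ D(X,Y) copies of the word 1 0ᶜ⁺¹ 1.  Words are
-- palindromes, so a flip of X lifts to a flip of its code and d(x,y) ≤ D(X,Y).
-- Conversely, let j < M flips transform x into y.  Each of them cuts at most one word,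
-- and since 10 occurs in y only at the start of a word, every uncut word ends up on
-- a word of y of the same symbol.  By Hall's theorem there are uncut words, one from
-- the block of each symbol of X, that end up in distinct blocks of y.  Restricted to
-- these words the j flips act as at most j flips transforming X into Y.
module Submission where

open import Data.Nat hiding (∣_-_∣)
open import Data.Nat.Properties
open import Data.Bool using (true; false; not)
open import Data.Bool.Properties using (T?)
open import Data.Fin using (Fin; toℕ)
import Data.Fin as F
open import Data.Fin.Patterns
import Data.Fin.Properties as F
open import Data.Fin.Subset
open import Data.Fin.Subset.Properties
  using (_∈?_; _⊆?_; nonempty?; anySubset?; ∈⊤; ∣⊤∣≡n; x∈⁅x⁆; x∈⁅y⁆⇒x≡y; ∣⁅x⁆∣≡1;
         p⊆q⇒∣p∣≤∣q∣; ∣∁p∣≡n∸∣p∣; ∣p∣≤n; x∈p∩q⁺; x∈p∩q⁻; ∣p∩q∣≤∣q∣; p⊆p∪q; q⊆p∪q; x∈p∪q⁻;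
         x∈p∧x∉q⇒x∈p─q; p─q⊆p; p∩q≢∅⇒∣p─q∣<∣p∣; x∈p⇒∣p-x∣<∣p∣)
open import Data.List
  using (List; []; _∷_; _++_; [_]; length; take; drop; reverse; map; concatMap; replicate; foldl; allFin; filter)
import Data.List as List
open import Data.List.Membership.Propositional using () renaming (_∈_ to _∈ˡ_)
open import Data.List.Membership.Propositional.Properties using (∈-∃++; ∈-map⁺; ∈-allFin)
open import Data.List.Properties
open import Data.List.Relation.Binary.Permutation.Propositional using (_↭_; ↭-refl; ↭-sym; ↭-trans; ↭-reflexive)
open import Data.List.Relation.Binary.Permutation.Propositional.Properties using (++⁺ʳ; ↭-reverse; ↭-length; filter-↭; ∈-resp-↭)
open import Data.List.Relation.Binary.Pointwise using (Pointwise-≡⇒≡)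
open import Data.List.Relation.Binary.Sublist.Heterogeneous.Properties using (toPointwise)
open import Data.List.Relation.Binary.Sublist.Propositional
  using ([]; _∷_; _∷ʳ_; minimum; ⊆-refl; ⊆-trans; ⊆-reflexive) renaming (_⊆_ to _⊆ˡ_)
import Data.List.Relation.Binary.Sublist.Propositional.Properties as Sublist
open import Data.List.Relation.Unary.All using (All; []; _∷_)
import Data.List.Relation.Unary.All as All
import Data.List.Relation.Unary.All.Properties as All
open import Data.List.Relation.Unary.AllPairs using (AllPairs; []; _∷_)
import Data.List.Relation.Unary.AllPairs.Properties as AllPairs
open import Data.List.Relation.Unary.Any using (here; there)
import Data.List.Relation.Unary.Any as Any
open import Data.Product using (_×_; _,_; proj₁; proj₂; ∃₂; ∃-syntax; Σ-syntax; map₁)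
open import Data.Product.Properties using () renaming (≡-dec to ×-≡-dec)
open import Data.Sum using (_⊎_; inj₁; inj₂)
open import Data.Unit using (tt) renaming (⊤ to Unit)
open import Data.Vec using ([]; _∷_; lookup; _[_]≔_)
import Data.Vec as Vec
import Data.Vec.Properties as Vec
open import Function using (_∘_; flip; id)
open import Relation.Binary.PropositionalEquality hiding ([_])
open import Relation.Nullary
open import Relation.Nullary.Decidable using (_×-dec_; dec-true; does; map′)
open import Defs

-- The obstacle is that a flip of the code may cut a word or separate the copies of one symbol, so
-- it need not come from a flip of X. Repetition makes the damage affordable. Let R be a set of
-- blocks of y and n the length of X. Of the at least Mn - j uncut words, at most M(n - |R|) end
-- outside R, so at least M|R| - j end inside it. They come from blocks with at most M words each,
-- and j < M leaves at least |R| such blocks: this is Hall's condition. Since symbols may repeat,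
-- blocks are labelled by positions of the strings and the matching is between positions; symbols
-- enter through the fact that an uncut word lands on an equal word. M need not be obtained from
-- D(X,Y) itself: two flips put any symbol in its final place, so D(X,Y) ≤ 2n. For minimality only j
-- < D(X,Y) has to be excluded, whence j < M.

private variable
  a b k n : ℕ
  A B : Set


-- Flip sequences, existence of distances, and the bound of two flips per symbol.

infix 4 _↝[_]_

-- "At most k" is the stable notion: when a flip is lifted to another string or restricted to part
-- of a string, its prefix may become empty, and it then disappears.
_↝[_]_ : String a → ℕ → String a → Set
s ↝[ k ] t = ∃[ j ] (j ≤ k × Flips j s t)

↝-weaken : ∀ {s t : String a} {k l} → k ≤ l → s ↝[ k ] t → s ↝[ l ] t
↝-weaken k≤l (j , j≤k , fl) = j , ≤-trans j≤k k≤l , fl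

prefixReversal-++ : (p q : String a) → prefixReversal (length p) (p ++ q) ≡ reverse p ++ q
prefixReversal-++ p q = cong₂ (λ u v → reverse u ++ v) (take-length-++ p) (drop-length-++ p)
  where
  take-length-++ : ∀ (p : List (Fin _)) → take (length p) (p ++ q) ≡ p
  take-length-++ []      = refl
  take-length-++ (x ∷ p) = cong (x ∷_) (take-length-++ p)
  drop-length-++ : ∀ (p : List (Fin _)) → drop (length p) (p ++ q) ≡ q
  drop-length-++ []      = refl
  drop-length-++ (x ∷ p) = drop-length-++ p

flip-prefix : ∀ (p : String a) {q t k} → reverse p ++ q ↝[ k ] t → p ++ q ↝[ suc k ] t
flip-prefix []      r              = ↝-weaken (n≤1+n _) r
flip-prefix (x ∷ p) {q} (j , j≤k , fl) =
  suc j , s≤s j≤k ,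
  step (suc (length p)) (s≤s z≤n) (length-++-≤ˡ (x ∷ p))
    (subst (λ s → Flips j s _) (sym (prefixReversal-++ (x ∷ p) q)) fl)

-- Used with `enc M` for the upper bound on d(x,y), and with a relabelling `map u` to turn flips of
-- positions into flips of symbols.
Flips-lift : (f : String a → String b) →
             (∀ s t → f (s ++ t) ≡ f s ++ f t) → (∀ s → f (reverse s) ≡ reverse (f s)) →
             ∀ {k s t} → Flips k s t → f s ↝[ k ] f t
Flips-lift f f-++ f-rev done = 0 , z≤n , done
Flips-lift f f-++ f-rev {s = s} {t} (step i _ _ fl) =
  subst (_↝[ _ ] f t)
    (trans (sym (f-++ (take i s) (drop i s))) (cong f (take++drop≡id i s)))
    (flip-prefix (f (take i s))
      (subst (_↝[ _ ] f t)
        (trans (f-++ _ _) (cong (_++ f (drop i s)) (f-rev (take i s))))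
        (Flips-lift f f-++ f-rev fl)))

Flips-↭ : ∀ {k} {s t : String a} → Flips k s t → s ↭ t
Flips-↭ done = ↭-refl
Flips-↭ {s = s} (step i _ _ fl) = ↭-trans
  (↭-trans (↭-reflexive (sym (take++drop≡id i s))) (++⁺ʳ (drop i s) (↭-sym (↭-reverse (take i s)))))
  (Flips-↭ fl)

↭⇒Compatible : {s t : String a} → s ↭ t → Compatible s t
↭⇒Compatible p c = ↭-length (filter-↭ (c F.≟_) p)

-- Only finitely many prefix lengths can be tried at each step. Decidability is what lets `least`
-- extract a minimum constructively.
Flips? : ∀ k (s t : String a) → Dec (Flips k s t)
Flips? zero s t = map′ (λ { refl → done }) (λ { done → refl }) (≡-dec F._≟_ s t)
Flips? (suc k) s t =
  map′ (λ (i , fl) → step (suc (toℕ i)) (s≤s z≤n) (F.toℕ<n i) fl) from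
       (F.any? λ i → Flips? k (prefixReversal (suc (toℕ i)) s) t)
  where
  from : Flips (suc k) s t → ∃[ i ] Flips k (prefixReversal (suc (toℕ i)) s) t
  from (step (suc i) _ i<n fl) =
    F.fromℕ< i<n , subst (λ m → Flips k (prefixReversal (suc m) s) t) (sym (F.toℕ-fromℕ< i<n)) fl

least : ∀ {P : ℕ → Set} → (∀ k → Dec (P k)) → ∀ {k} → P k → ∃[ m ] (m ≤ k × P m × (∀ j → P j → m ≤ j))
least P? {zero} p = 0 , z≤n , p , λ _ _ → z≤n
least {P} P? {suc k} p with P? 0
... | yes p₀ = 0 , z≤n , p₀ , λ _ _ → z≤n
... | no ¬p₀ with least {λ j → P (suc j)} (λ j → P? (suc j)) p
... | m , m≤k , q , min = suc m , s≤s m≤k , q , λ { zero p₀ → contradiction p₀ ¬p₀ ; (suc j) pj → s≤s (min j pj) }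

distance : ∀ {s t : String a} {k} → s ↝[ k ] t → ∃[ d ] (d ≤ k × IsDistance s t d)
distance {s = s} {t} (j , j≤k , fl) with least (λ i → Flips? i s t) fl
... | d , d≤j , fd , min = d , ≤-trans d≤j j≤k , fd , min

↝-++ʳ : ∀ {s t : String a} {k} (w : String a) → s ↝[ k ] t → s ++ w ↝[ k ] t ++ w
↝-++ʳ {a} {t = t} w (j , j≤k , fl) = ↝-weaken j≤k (go fl)
  where
  go : ∀ {s k} → Flips k s t → s ++ w ↝[ k ] t ++ w
  go done = 0 , z≤n , done
  go {s} (step i _ _ fl) =
    subst (_↝[ _ ] _) (trans (sym (++-assoc (take i s) (drop i s) w)) (cong (_++ w) (take++drop≡id i s)))
      (flip-prefix (take i s)
        (subst (_↝[ _ ] _) (++-assoc (reverse (take i s)) (drop i s) w) (go fl)))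

count-++ : ∀ (c : Fin a) s t → count c (s ++ t) ≡ count c s + count c t
count-++ c s t = trans (cong length (filter-++ (c F.≟_) s t)) (length-++ (filter (c F.≟_) s))

count-∈ : ∀ (c : Fin a) s → 0 < count c s → c ∈ˡ s
count-∈ c s pos with Any.any? (c F.≟_) s
... | yes c∈s = c∈s
... | no  c∉s = contradiction (subst (0 <_) (cong length (filter-none (c F.≟_) (All.¬Any⇒All¬ s c∉s))) pos) λ ()

-- The target is given reversed so that the recursion settles its last symbol first.
two-flips-per-symbol : ∀ (u s : String a) → Compatible s (reverse u) → s ↝[ 2 * length u ] reverse u
two-flips-per-symbol [] [] _ = 0 , z≤n , done
two-flips-per-symbol [] (x ∷ s) comp =
  contradiction (trans (sym (cong length (filter-accept (x F.≟_) refl))) (comp x)) λ ()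
two-flips-per-symbol (c ∷ u) s comp with ∈-∃++ (count-∈ c s pos)
  where
  pos : 0 < count c s
  pos = subst (0 <_)
    (sym (trans (comp c) (trans (cong (count c) (unfold-reverse c u)) (trans (count-++ c (reverse u) [ c ])
      (cong (count c (reverse u) +_) (cong length (filter-accept (c F.≟_) {xs = []} refl)))))))
    (m≤n+m 1 (count c (reverse u)))
... | p , q , refl =
  -- Flipping `p ++ [ c ]` brings this `c` to the front, and flipping the whole string then puts it
  -- last, where the recursion leaves it alone.
  subst (λ m → p ++ c ∷ q ↝[ m ] reverse (c ∷ u)) (sym (*-suc 2 (length u)))
    (subst₂ (_↝[ _ ]_) (++-assoc p [ c ] q) (sym (unfold-reverse c u))
      (flip-prefix (p ++ [ c ])
        (subst (_↝[ _ ] _) (trans (++-identityʳ (c ∷ reverse p ++ q)) (cong (_++ q) (sym (reverse-++ p [ c ]))))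
          (flip-prefix (c ∷ reverse p ++ q)
            (subst (_↝[ _ ] _) eq (↝-++ʳ [ c ] (two-flips-per-symbol u (reverse q ++ p) comp′)))))))
  where
  eq : (reverse q ++ p) ++ [ c ] ≡ reverse (c ∷ reverse p ++ q) ++ []
  eq = sym (begin
    reverse (c ∷ reverse p ++ q) ++ []     ≡⟨ ++-identityʳ _ ⟩
    reverse (c ∷ reverse p ++ q)           ≡⟨ unfold-reverse c (reverse p ++ q) ⟩
    reverse (reverse p ++ q) ++ [ c ]      ≡⟨ cong (_++ [ c ]) (reverse-++ (reverse p) q) ⟩
    (reverse q ++ reverse (reverse p)) ++ [ c ] ≡⟨ cong (λ r → (reverse q ++ r) ++ [ c ]) (reverse-involutive p) ⟩
    (reverse q ++ p) ++ [ c ]              ∎)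
    where open ≡-Reasoning
  comp′ : Compatible (reverse q ++ p) (reverse u)
  comp′ d = +-cancelʳ-≡ (count d [ c ]) _ _ (begin
    count d (reverse q ++ p) + count d [ c ]  ≡⟨ count-++ d (reverse q ++ p) [ c ] ⟨
    count d ((reverse q ++ p) ++ [ c ])       ≡⟨ ↭⇒Compatible (↭-trans (↭-reflexive eq′) (↭-reverse (reverse p′ ++ q))) d ⟩
    count d (reverse p′ ++ q)                 ≡⟨ ↭⇒Compatible (++⁺ʳ q (↭-reverse p′)) d ⟩
    count d (p′ ++ q)                         ≡⟨ cong (count d) (++-assoc p [ c ] q) ⟩
    count d (p ++ c ∷ q)                      ≡⟨ comp d ⟩
    count d (reverse (c ∷ u))                 ≡⟨ cong (count d) (unfold-reverse c u) ⟩
    count d (reverse u ++ [ c ])              ≡⟨ count-++ d (reverse u) [ c ] ⟩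
    count d (reverse u) + count d [ c ]       ∎)
    where
    open ≡-Reasoning
    p′ = p ++ [ c ]
    eq′ : (reverse q ++ p) ++ [ c ] ≡ reverse (reverse p′ ++ q)
    eq′ = trans eq (trans (++-identityʳ _) (cong (λ r → reverse (r ++ q)) (sym (reverse-++ p [ c ]))))

Compatible⇒↝ : (s t : String a) → Compatible s t → s ↝[ 2 * length t ] t
Compatible⇒↝ s t comp =
  subst₂ (λ l r → s ↝[ 2 * l ] r) (length-reverse t) (reverse-involutive t)
    (two-flips-per-symbol (reverse t) s (subst (Compatible s) (sym (reverse-involutive t)) comp))

-- Hall's theorem for finite bipartite graphs.

∣p∣≡∣p∩q∣+∣p─q∣ : ∀ {n} (p q : Subset n) → ∣ p ∣ ≡ ∣ p ∩ q ∣ + ∣ p ─ q ∣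
∣p∣≡∣p∩q∣+∣p─q∣ []           []          = refl
∣p∣≡∣p∩q∣+∣p─q∣ (true ∷ p)  (true ∷ q)  = cong suc (∣p∣≡∣p∩q∣+∣p─q∣ p q)
∣p∣≡∣p∩q∣+∣p─q∣ (true ∷ p)  (false ∷ q) =
  trans (cong suc (∣p∣≡∣p∩q∣+∣p─q∣ p q)) (sym (+-suc ∣ p ∩ q ∣ ∣ p ─ q ∣))
∣p∣≡∣p∩q∣+∣p─q∣ (false ∷ p) (true ∷ q)  = ∣p∣≡∣p∩q∣+∣p─q∣ p q
∣p∣≡∣p∩q∣+∣p─q∣ (false ∷ p) (false ∷ q) = ∣p∣≡∣p∩q∣+∣p─q∣ p q

0<∣p∣⇒Nonempty : ∀ {n} (p : Subset n) → 0 < ∣ p ∣ → Nonempty p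
0<∣p∣⇒Nonempty (true ∷ p)  _ = Fin.zero , Vec.here
0<∣p∣⇒Nonempty (false ∷ p) pos with 0<∣p∣⇒Nonempty p pos
... | i , i∈p = Fin.suc i , Vec.there i∈p

x∈p─q⇒x∉q : ∀ {n x} (p q : Subset n) → x ∈ p ─ q → x ∉ q
x∈p─q⇒x∉q (_ ∷ p) (_ ∷ q) (Vec.there x∈) (Vec.there x∈q) = x∈p─q⇒x∉q p q x∈ x∈q

module Hall {m n} {E : Fin m → Fin n → Set} (E? : ∀ i j → Dec (E i j)) (f₀ : Fin m → Fin n) where

  private
    adjacent? : ∀ S j → Dec (∃[ i ] (i ∈ S × E i j))
    adjacent? S j = F.any? λ i → (i ∈? S) ×-dec E? i j

  neighbours : Subset m → Subset n
  neighbours S = Vec.tabulate λ j → does (adjacent? S j)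

  ∈neighbours⁺ : ∀ {i j} S → i ∈ S → E i j → j ∈ neighbours S
  ∈neighbours⁺ {i} {j} S i∈S e = Vec.lookup⇒[]= j _
    (trans (Vec.lookup∘tabulate _ j) (dec-true (adjacent? S j) (i , i∈S , e)))

  ∈neighbours⁻ : ∀ {j} S → j ∈ neighbours S → ∃[ i ] (i ∈ S × E i j)
  ∈neighbours⁻ {j} S j∈N
    with adjacent? S j | trans (sym (Vec.lookup∘tabulate (λ j → does (adjacent? S j)) j)) (Vec.[]=⇒lookup j∈N)
  ... | yes adj | _ = adj

  -- A total function constrained only on `S`, so that matchings of disjoint parts can be glued by
  -- case distinction. The module parameter `f₀` provides such a function when `S` is empty.
  Matching : Subset m → Subset n → Set
  Matching S T = Σ[ f ∈ (Fin m → Fin n) ] ((∀ {i} → i ∈ S → f i ∈ T × E i (f i)) ×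
                         (∀ {i j} → i ∈ S → j ∈ S → f i ≡ f j → i ≡ j))

  Condition : Subset m → Subset n → Set
  Condition S T = ∀ R → R ⊆ S → ∣ R ∣ ≤ ∣ neighbours R ∩ T ∣

  private
    neighbours-∪-∩ : ∀ {j} R S T → j ∈ neighbours (R ∪ S) ∩ T ─ neighbours S → j ∈ neighbours R ∩ (T ─ neighbours S)
    neighbours-∪-∩ R S T j∈ with x∈p∩q⁻ _ T (p─q⊆p _ (neighbours S) j∈)
    ... | j∈N , j∈T with ∈neighbours⁻ (R ∪ S) j∈N
    ... | i , i∈ , e with x∈p∪q⁻ R S i∈
    ... | inj₁ i∈R = x∈p∩q⁺ (∈neighbours⁺ R i∈R e , x∈p∧x∉q⇒x∈p─q j∈T (x∈p─q⇒x∉q _ (neighbours S) j∈))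
    ... | inj₂ i∈S = contradiction (∈neighbours⁺ S i∈S e) (x∈p─q⇒x∉q _ (neighbours S) j∈)

  condition-∩ : ∀ S S′ T → S′ ⊆ S → Condition S T → Condition S′ (T ∩ neighbours S′)
  condition-∩ S S′ T S′⊆S cond R R⊆S′ = ≤-trans (cond R (λ i∈ → S′⊆S (R⊆S′ i∈))) (p⊆q⇒∣p∣≤∣q∣ sub)
    where
    sub : neighbours R ∩ T ⊆ neighbours R ∩ (T ∩ neighbours S′)
    sub j∈ with x∈p∩q⁻ (neighbours R) T j∈
    ... | j∈N , j∈T with ∈neighbours⁻ R j∈N
    ... | i , i∈R , e = x∈p∩q⁺ (j∈N , x∈p∩q⁺ (j∈T , ∈neighbours⁺ S′ (R⊆S′ i∈R) e))

  -- Apply the condition to `R ∪ S′`. As `S′` is critical, at most `∣ S′ ∣` of the neighbours found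
  -- in `T` are neighbours of `S′`, so at least `∣ R ∣` of them survive the removal.
  condition-─ : ∀ S S′ T → S′ ⊆ S → ∣ neighbours S′ ∩ T ∣ ≤ ∣ S′ ∣ → Condition S T →
                Condition (S ─ S′) (T ─ neighbours S′)
  condition-─ S S′ T S′⊆S crit cond R R⊆ = +-cancelˡ-≤ ∣ S′ ∣ _ _ (begin
    ∣ S′ ∣ + ∣ R ∣                              ≤⟨ +-mono-≤ (p⊆q⇒∣p∣≤∣q∣ sub₁) (p⊆q⇒∣p∣≤∣q∣ sub₂) ⟩
    ∣ (R ∪ S′) ∩ S′ ∣ + ∣ (R ∪ S′) ─ S′ ∣        ≡⟨ ∣p∣≡∣p∩q∣+∣p─q∣ (R ∪ S′) S′ ⟨
    ∣ R ∪ S′ ∣                                  ≤⟨ cond (R ∪ S′) sub₃ ⟩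
    ∣ U ∣                                       ≡⟨ ∣p∣≡∣p∩q∣+∣p─q∣ U (neighbours S′) ⟩
    ∣ U ∩ neighbours S′ ∣ + ∣ U ─ neighbours S′ ∣ ≤⟨ +-mono-≤ (≤-trans (p⊆q⇒∣p∣≤∣q∣ sub₄) crit) (p⊆q⇒∣p∣≤∣q∣ (neighbours-∪-∩ R S′ T)) ⟩
    ∣ S′ ∣ + ∣ neighbours R ∩ (T ─ neighbours S′) ∣ ∎)
    where
    open ≤-Reasoning
    U = neighbours (R ∪ S′) ∩ T
    sub₁ : S′ ⊆ (R ∪ S′) ∩ S′
    sub₁ i∈ = x∈p∩q⁺ (q⊆p∪q R S′ i∈ , i∈)
    sub₂ : R ⊆ (R ∪ S′) ─ S′
    sub₂ i∈ = x∈p∧x∉q⇒x∈p─q (p⊆p∪q S′ i∈) (x∈p─q⇒x∉q S S′ (R⊆ i∈))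
    sub₃ : R ∪ S′ ⊆ S
    sub₃ i∈ with x∈p∪q⁻ R S′ i∈
    ... | inj₁ i∈R = p─q⊆p S S′ (R⊆ i∈R)
    ... | inj₂ i∈S′ = S′⊆S i∈S′
    sub₄ : U ∩ neighbours S′ ⊆ neighbours S′ ∩ T
    sub₄ j∈ with x∈p∩q⁻ U (neighbours S′) j∈
    ... | j∈U , j∈N = x∈p∩q⁺ (j∈N , proj₂ (x∈p∩q⁻ (neighbours (R ∪ S′)) T j∈U))

  matching-∪ : ∀ S S′ T T′ → Matching S′ (T ∩ T′) → Matching (S ─ S′) (T ─ T′) → Matching S T
  matching-∪ S S′ T T′ (f , f∈ , f-inj) (g , g∈ , g-inj) = h , h∈ , h-inj
    where
    h : Fin m → Fin n
    h i with i ∈? S′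
    ... | yes _ = f i
    ... | no  _ = g i
    h∈ : ∀ {i} → i ∈ S → h i ∈ T × E i (h i)
    h∈ {i} i∈S with i ∈? S′
    ... | yes i∈S′ = proj₁ (x∈p∩q⁻ T T′ (proj₁ (f∈ i∈S′))) , proj₂ (f∈ i∈S′)
    ... | no  i∉S′ = let g∈T , e = g∈ (x∈p∧x∉q⇒x∈p─q i∈S i∉S′) in p─q⊆p T T′ g∈T , e
    separate : ∀ {i j} → i ∈ S′ → j ∈ S ─ S′ → f i ≢ g j
    separate i∈ j∈ eq = x∈p─q⇒x∉q T T′ (proj₁ (g∈ j∈))
      (subst (_∈ T′) eq (proj₂ (x∈p∩q⁻ T T′ (proj₁ (f∈ i∈)))))
    h-inj : ∀ {i j} → i ∈ S → j ∈ S → h i ≡ h j → i ≡ j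
    h-inj {i} {j} i∈S j∈S eq with i ∈? S′ | j ∈? S′
    ... | yes i∈ | yes j∈ = f-inj i∈ j∈ eq
    ... | yes i∈ | no  j∉ = contradiction eq (separate i∈ (x∈p∧x∉q⇒x∈p─q j∈S j∉))
    ... | no  i∉ | yes j∈ = contradiction (sym eq) (separate j∈ (x∈p∧x∉q⇒x∈p─q i∈S i∉))
    ... | no  i∉ | no  j∉ = g-inj (x∈p∧x∉q⇒x∈p─q i∈S i∉) (x∈p∧x∉q⇒x∈p─q j∈S j∉) eq

  matching-⁅⁆ : ∀ {i j} T → j ∈ T → E i j → Matching ⁅ i ⁆ (T ∩ ⁅ j ⁆)
  matching-⁅⁆ {i} {j} T j∈T e =
    (λ _ → j) ,
    (λ i′∈ → x∈p∩q⁺ (j∈T , x∈⁅x⁆ j) , subst (λ i → E i j) (sym (x∈⁅y⁆⇒x≡y i i′∈)) e) ,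
    λ k∈ l∈ _ → trans (x∈⁅y⁆⇒x≡y i k∈) (sym (x∈⁅y⁆⇒x≡y i l∈))

  -- Halmos–Vaughan: either some nonempty proper R ⊂ S is critical, and S splits into
  -- R and S ─ R, or there is slack and an arbitrary edge can be chosen.
  matching : ∀ k S T → ∣ S ∣ ≤ k → Condition S T → Matching S T
  matching zero S T ∣S∣≤0 cond = f₀ , (λ i∈ → contradiction i∈ (empty _)) , λ i∈ → contradiction i∈ (empty _)
    where
    empty : ∀ i → i ∉ S
    empty i i∈S = n≮0 (≤-trans (≤-<-trans z≤n (x∈p⇒∣p-x∣<∣p∣ i∈S)) ∣S∣≤0)
  matching (suc k) S T ∣S∣≤1+k cond
    with anySubset? (λ R → (R ⊆? S) ×-dec ((0 <? ∣ R ∣) ×-dec ((∣ R ∣ <? ∣ S ∣) ×-dec (∣ neighbours R ∩ T ∣ ≤? ∣ R ∣))))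
  ... | yes (R , R⊆S , 0<∣R∣ , ∣R∣<∣S∣ , crit) =
    matching-∪ S R T (neighbours R)
      (matching k R _ (s≤s⁻¹ (≤-trans ∣R∣<∣S∣ ∣S∣≤1+k)) (condition-∩ S R T R⊆S cond))
      (matching k (S ─ R) _ (s≤s⁻¹ (≤-trans ∣S─R∣<∣S∣ ∣S∣≤1+k)) (condition-─ S R T R⊆S crit cond))
    where
    ∣S─R∣<∣S∣ : ∣ S ─ R ∣ < ∣ S ∣
    ∣S─R∣<∣S∣ with 0<∣p∣⇒Nonempty R 0<∣R∣
    ... | i , i∈R = p∩q≢∅⇒∣p─q∣<∣p∣ S R (i , x∈p∩q⁺ (R⊆S i∈R , i∈R))
  ... | no ¬crit with nonempty? S
  ... | no empty = f₀ , (λ i∈ → contradiction (_ , i∈) empty) , λ i∈ → contradiction (_ , i∈) empty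
  ... | yes (i , i∈S) with 0<∣p∣⇒Nonempty (neighbours ⁅ i ⁆ ∩ T) (subst (_≤ ∣ neighbours ⁅ i ⁆ ∩ T ∣) (∣⁅x⁆∣≡1 i) (cond ⁅ i ⁆ ⁅i⁆⊆S))
    where
    ⁅i⁆⊆S : ⁅ i ⁆ ⊆ S
    ⁅i⁆⊆S j∈ = subst (_∈ S) (sym (x∈⁅y⁆⇒x≡y i j∈)) i∈S
  ... | j , j∈ with x∈p∩q⁻ (neighbours ⁅ i ⁆) T j∈
  ... | j∈N , j∈T with ∈neighbours⁻ ⁅ i ⁆ j∈N
  ... | i′ , i′∈ , e =
    matching-∪ S ⁅ i ⁆ T ⁅ j ⁆ (matching-⁅⁆ T j∈T (subst (λ i → E i j) (x∈⁅y⁆⇒x≡y i i′∈) e))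
      (matching k (S - i) (T - j) (s≤s⁻¹ (≤-trans (x∈p⇒∣p-x∣<∣p∣ i∈S) ∣S∣≤1+k)) cond′)
    where
    cond′ : Condition (S - i) (T - j)
    cond′ R R⊆ with 0 <? ∣ R ∣
    ... | no  ≮ = subst (_≤ ∣ neighbours R ∩ (T - j) ∣) (sym (n≤0⇒n≡0 (≮⇒≥ ≮))) z≤n
    ... | yes 0<∣R∣ = s≤s⁻¹ (begin-strict
      ∣ R ∣                     <⟨ ≰⇒> (λ crit → ¬crit (R , (λ r → p─q⊆p S ⁅ i ⁆ (R⊆ r)) , 0<∣R∣ , ≤-<-trans (p⊆q⇒∣p∣≤∣q∣ R⊆) (x∈p⇒∣p-x∣<∣p∣ i∈S) , crit)) ⟩
      ∣ U ∣                     ≡⟨ ∣p∣≡∣p∩q∣+∣p─q∣ U ⁅ j ⁆ ⟩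
      ∣ U ∩ ⁅ j ⁆ ∣ + ∣ U - j ∣   ≤⟨ +-mono-≤ (≤-trans (∣p∩q∣≤∣q∣ U ⁅ j ⁆) (≤-reflexive (∣⁅x⁆∣≡1 j))) (p⊆q⇒∣p∣≤∣q∣ sub) ⟩
      1 + ∣ neighbours R ∩ (T - j) ∣ ∎)
      where
      open ≤-Reasoning
      U = neighbours R ∩ T
      sub : U - j ⊆ neighbours R ∩ (T - j)
      sub x∈ with x∈p∩q⁻ (neighbours R) T (p─q⊆p U ⁅ j ⁆ x∈)
      ... | x∈N , x∈T = x∈p∩q⁺ (x∈N , x∈p∧x∉q⇒x∈p─q x∈T (x∈p─q⇒x∉q U ⁅ j ⁆ x∈))

-- The binary encoding and the lifting of flips to it.

-- The extra zero gives even the symbol 0 an occurrence of 10. It is written after the `c` others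
-- because the program pushes 1, 0, the `c` zeros and 1 in this order.
tok : ℕ → List Bit
tok c = 1F ∷ replicate c 0F ++ 0F ∷ 1F ∷ []

blocks : ℕ → List A → List A
blocks M = concatMap (replicate M)

enc : ℕ → String a → String 2
enc M X = concatMap tok (blocks M (map toℕ X))

reverse-concatMap : (f : A → List B) → (∀ x → reverse (f x) ≡ f x) →
                    ∀ xs → reverse (concatMap f xs) ≡ concatMap f (reverse xs)
reverse-concatMap f pal []       = refl
reverse-concatMap f pal (x ∷ xs) = begin
  reverse (f x ++ concatMap f xs)             ≡⟨ reverse-++ (f x) _ ⟩
  reverse (concatMap f xs) ++ reverse (f x)   ≡⟨ cong₂ _++_ (reverse-concatMap f pal xs) (trans (pal x) (sym (++-identityʳ (f x)))) ⟩
  concatMap f (reverse xs) ++ concatMap f [ x ] ≡⟨ concatMap-++ f (reverse xs) [ x ] ⟨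
  concatMap f (reverse xs ++ [ x ])           ≡⟨ cong (concatMap f) (unfold-reverse x xs) ⟨
  concatMap f (reverse (x ∷ xs))              ∎
  where open ≡-Reasoning

replicate-++ : ∀ k (x : A) xs → replicate k x ++ x ∷ xs ≡ x ∷ replicate k x ++ xs
replicate-++ zero    x xs = refl
replicate-++ (suc k) x xs = cong (x ∷_) (replicate-++ k x xs)

reverse-replicate : ∀ k (x : A) → reverse (replicate k x) ≡ replicate k x
reverse-replicate zero    x = refl
reverse-replicate (suc k) x = begin
  reverse (x ∷ replicate k x)     ≡⟨ unfold-reverse x (replicate k x) ⟩
  reverse (replicate k x) ++ [ x ] ≡⟨ cong (_++ [ x ]) (reverse-replicate k x) ⟩
  replicate k x ++ [ x ]          ≡⟨ replicate-++ k x [] ⟩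
  x ∷ replicate k x ++ []         ≡⟨ cong (x ∷_) (++-identityʳ _) ⟩
  x ∷ replicate k x               ∎
  where open ≡-Reasoning

tok-palindrome : ∀ c → reverse (tok c) ≡ tok c
tok-palindrome c = begin
  reverse (1F ∷ replicate c 0F ++ 0F ∷ 1F ∷ [])      ≡⟨ cong (λ w → reverse (1F ∷ w)) (replicate-++ c 0F [ 1F ]) ⟩
  reverse (1F ∷ replicate (suc c) 0F ++ [ 1F ])      ≡⟨ unfold-reverse 1F (replicate (suc c) 0F ++ [ 1F ]) ⟩
  reverse (replicate (suc c) 0F ++ [ 1F ]) ++ [ 1F ] ≡⟨ cong (_++ [ 1F ]) (reverse-++ (replicate (suc c) 0F) [ 1F ]) ⟩
  1F ∷ reverse (replicate (suc c) 0F) ++ [ 1F ]      ≡⟨ cong (λ w → 1F ∷ w ++ [ 1F ]) (reverse-replicate (suc c) 0F) ⟩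
  1F ∷ replicate (suc c) 0F ++ [ 1F ]                ≡⟨ cong (1F ∷_) (replicate-++ c 0F [ 1F ]) ⟨
  tok c                                              ∎
  where open ≡-Reasoning

blocks-++ : ∀ M (xs ys : List A) → blocks M (xs ++ ys) ≡ blocks M xs ++ blocks M ys
blocks-++ M = concatMap-++ (replicate M)

map-blocks : ∀ M (f : A → B) xs → map f (blocks M xs) ≡ blocks M (map f xs)
map-blocks M f []       = refl
map-blocks M f (x ∷ xs) =
  trans (map-++ f (replicate M x) _) (cong₂ _++_ (map-replicate f M x) (map-blocks M f xs))

enc-++ : ∀ M (s t : String a) → enc M (s ++ t) ≡ enc M s ++ enc M t
enc-++ M s t = trans
  (cong (concatMap tok) (trans (cong (blocks M) (map-++ toℕ s t)) (blocks-++ M (map toℕ s) (map toℕ t))))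
  (concatMap-++ tok (blocks M (map toℕ s)) _)

enc-reverse : ∀ M (s : String a) → enc M (reverse s) ≡ reverse (enc M s)
enc-reverse M s = begin
  concatMap tok (blocks M (map toℕ (reverse s)))  ≡⟨ cong (concatMap tok ∘ blocks M) (reverse-map toℕ s) ⟩
  concatMap tok (blocks M (reverse (map toℕ s)))  ≡⟨ cong (concatMap tok) (reverse-concatMap (replicate M) (reverse-replicate M) (map toℕ s)) ⟨
  concatMap tok (reverse (blocks M (map toℕ s)))  ≡⟨ reverse-concatMap tok tok-palindrome (blocks M (map toℕ s)) ⟨
  reverse (enc M s)                               ∎
  where open ≡-Reasoning

enc-map : ∀ M (f : A → Fin a) xs → enc M (map f xs) ≡ concatMap (tok ∘ toℕ ∘ f) (blocks M xs)
enc-map M f xs = begin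
  concatMap tok (blocks M (map toℕ (map f xs)))  ≡⟨ cong (concatMap tok ∘ blocks M) (map-∘ xs) ⟨
  concatMap tok (blocks M (map (toℕ ∘ f) xs))    ≡⟨ cong (concatMap tok) (map-blocks M (toℕ ∘ f) xs) ⟨
  concatMap tok (map (toℕ ∘ f) (blocks M xs))    ≡⟨ concatMap-map tok (toℕ ∘ f) (blocks M xs) ⟩
  concatMap (tok ∘ toℕ ∘ f) (blocks M xs)        ∎
  where open ≡-Reasoning

enc-↝ : ∀ M {X Y : String a} {k} → Flips k X Y → enc M X ↝[ k ] enc M Y
enc-↝ M = Flips-lift (enc M) (enc-++ M) (enc-reverse M)

-- Tracking the words that survive a sequence of flips.

-- Partially parsed binary strings: inj₁ x stands for an intact word tok (u x).
labels : List (A ⊎ Bit) → List A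
labels []           = []
labels (inj₁ x ∷ τ) = x ∷ labels τ
labels (inj₂ _ ∷ τ) = labels τ

labels-++ : (τ σ : List (A ⊎ Bit)) → labels (τ ++ σ) ≡ labels τ ++ labels σ
labels-++ []           σ = refl
labels-++ (inj₁ x ∷ τ) σ = cong (x ∷_) (labels-++ τ σ)
labels-++ (inj₂ _ ∷ τ) σ = labels-++ τ σ

labels-reverse : (τ : List (A ⊎ Bit)) → labels (reverse τ) ≡ reverse (labels τ)
labels-reverse []       = refl
labels-reverse (t ∷ τ) = trans (cong labels (unfold-reverse t τ)) (trans (labels-++ (reverse τ) [ t ]) (lemma t))
  where
  lemma : ∀ t → labels (reverse τ) ++ labels [ t ] ≡ reverse (labels (t ∷ τ))
  lemma (inj₁ x) = trans (cong (_++ [ x ]) (labels-reverse τ)) (sym (unfold-reverse x (labels τ)))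
  lemma (inj₂ _) = trans (++-identityʳ _) (labels-reverse τ)

labels-map-inj₁ : (xs : List A) → labels (map inj₁ xs) ≡ xs
labels-map-inj₁ []       = refl
labels-map-inj₁ (x ∷ xs) = cong (x ∷_) (labels-map-inj₁ xs)

labels-map-inj₂ : ∀ w → labels {A} (map inj₂ w) ≡ []
labels-map-inj₂ []      = refl
labels-map-inj₂ (_ ∷ w) = labels-map-inj₂ w

split-++ : ∀ i (w v : List A) →
  (∃[ j ] (take i (w ++ v) ≡ w ++ take j v × drop i (w ++ v) ≡ drop j v)) ⊎
  (take i (w ++ v) ≡ take i w × drop i (w ++ v) ≡ drop i w ++ v)
split-++ i       []      v = inj₁ (i , refl , refl)
split-++ zero    (x ∷ w) v = inj₂ (refl , refl)
split-++ (suc i) (x ∷ w) v with split-++ i w v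
... | inj₁ (j , eq₁ , eq₂) = inj₁ (j , cong (x ∷_) eq₁ , eq₂)
... | inj₂ (eq₁ , eq₂)     = inj₂ (cong (x ∷_) eq₁ , eq₂)

module Parse (u : A → ℕ) where

  expandToken : A ⊎ Bit → List Bit
  expandToken (inj₁ x) = tok (u x)
  expandToken (inj₂ b) = [ b ]

  expand : List (A ⊎ Bit) → List Bit
  expand = concatMap expandToken

  expand-map-inj₂ : ∀ w → expand (map inj₂ w) ≡ w
  expand-map-inj₂ []      = refl
  expand-map-inj₂ (b ∷ w) = cong (b ∷_) (expand-map-inj₂ w)

  expand-reverse : ∀ τ → expand (reverse τ) ≡ reverse (expand τ)
  expand-reverse τ = sym (reverse-concatMap expandToken (λ { (inj₁ x) → tok-palindrome (u x) ; (inj₂ _) → refl }) τ)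

  -- A cut strictly inside an intact word demotes both of its pieces to loose bits and loses one
  -- label; a cut anywhere else loses none.
  cut : ∀ i τ → ∃₂ λ τ₁ τ₂ → expand τ₁ ≡ take i (expand τ) × expand τ₂ ≡ drop i (expand τ) ×
        labels τ₁ ++ labels τ₂ ⊆ˡ labels τ × length (labels τ) ≤ suc (length (labels τ₁ ++ labels τ₂))
  cut zero    τ  = [] , τ , refl , refl , ⊆-refl , n≤1+n _
  cut (suc i) [] = [] , [] , refl , refl , ⊆-refl , n≤1+n _
  cut (suc i) (inj₂ b ∷ τ) with cut i τ
  ... | τ₁ , τ₂ , eq₁ , eq₂ , sub , len = inj₂ b ∷ τ₁ , τ₂ , cong (b ∷_) eq₁ , eq₂ , sub , len
  cut (suc i) (inj₁ x ∷ τ) with split-++ (suc i) (tok (u x)) (expand τ)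
  ... | inj₂ (eq₁ , eq₂) =
    map inj₂ (take (suc i) (tok (u x))) , map inj₂ (drop (suc i) (tok (u x))) ++ τ ,
    trans (expand-map-inj₂ _) (sym eq₁) ,
    trans (concatMap-++ expandToken (map inj₂ (drop (suc i) (tok (u x)))) τ) (trans (cong (_++ expand τ) (expand-map-inj₂ _)) (sym eq₂)) ,
    ⊆-trans (⊆-reflexive eq) (x ∷ʳ ⊆-refl) ,
    s≤s (≤-reflexive (sym (cong length eq)))
    where
    eq : labels (map inj₂ (take (suc i) (tok (u x)))) ++ labels (map inj₂ (drop (suc i) (tok (u x))) ++ τ) ≡ labels τ
    eq = cong₂ _++_ (labels-map-inj₂ (take (suc i) (tok (u x))))
           (trans (labels-++ (map inj₂ (drop (suc i) (tok (u x)))) τ) (cong (_++ labels τ) (labels-map-inj₂ (drop (suc i) (tok (u x))))))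
  ... | inj₁ (j , eq₁ , eq₂) with cut j τ
  ... | τ₁ , τ₂ , eq₁′ , eq₂′ , sub , len =
    inj₁ x ∷ τ₁ , τ₂ , trans (cong (tok (u x) ++_) eq₁′) (sym eq₁) , trans eq₂′ (sym eq₂) , refl ∷ sub , s≤s len

⊆-++⁻ : ∀ (ys : List A) {zs xs} → xs ⊆ˡ ys ++ zs →
        ∃₂ λ xs₁ xs₂ → xs ≡ xs₁ ++ xs₂ × xs₁ ⊆ˡ ys × xs₂ ⊆ˡ zs
⊆-++⁻ []       sub = [] , _ , refl , [] , sub
⊆-++⁻ (y ∷ ys) (.y ∷ʳ sub) with ⊆-++⁻ ys sub
... | xs₁ , xs₂ , eq , sub₁ , sub₂ = xs₁ , xs₂ , eq , y ∷ʳ sub₁ , sub₂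
⊆-++⁻ (y ∷ ys) (refl ∷ sub) with ⊆-++⁻ ys sub
... | xs₁ , xs₂ , eq , sub₁ , sub₂ = y ∷ xs₁ , xs₂ , cong (y ∷_) eq , refl ∷ sub₁ , sub₂

-- Each flip destroys at most the one word that it cuts, whence the summand k.
track : ∀ (u : Fin n → ℕ) (let open Parse u) {k x y} → Flips k x y → ∀ τ → x ≡ expand τ →
        ∃[ τ′ ] (y ≡ expand τ′ × length (labels τ) ≤ k + length (labels τ′) ×
                 (∀ {S′} → S′ ⊆ˡ labels τ′ → ∃[ S ] (S ⊆ˡ labels τ × S ↝[ k ] S′)))
track u done τ eq = τ , eq , ≤-refl , λ sub → _ , sub , 0 , z≤n , done
track u {suc k} {x} (step i _ _ fl) τ refl with Parse.cut u i τ
... | τ₁ , τ₂ , eq₁ , eq₂ , sub , len with track u fl (reverse τ₁ ++ τ₂) eq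
  where
  open Parse u
  eq : prefixReversal i (expand τ) ≡ expand (reverse τ₁ ++ τ₂)
  eq = sym (trans (concatMap-++ expandToken (reverse τ₁) τ₂)
         (cong₂ _++_ (trans (expand-reverse τ₁) (cong reverse eq₁)) eq₂))
... | τ′ , y≡ , len′ , pull = τ′ , y≡ , ≤-trans len (s≤s (≤-trans (≤-reflexive len≡) len′)) , pull′
  where
  lab : labels (reverse τ₁ ++ τ₂) ≡ reverse (labels τ₁) ++ labels τ₂
  lab = trans (labels-++ (reverse τ₁) τ₂) (cong (_++ labels τ₂) (labels-reverse τ₁))
  len≡ : length (labels τ₁ ++ labels τ₂) ≡ length (labels (reverse τ₁ ++ τ₂))
  len≡ = trans (sym (↭-length (++⁺ʳ (labels τ₂) (↭-reverse (labels τ₁))))) (cong length (sym lab))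
  -- Seen by the chosen words alone, the flip reverses those that lay in the flipped prefix, namely
  -- `reverse S₁`. If there are none, it costs nothing.
  pull′ : ∀ {S′} → S′ ⊆ˡ labels τ′ → ∃[ S ] (S ⊆ˡ labels τ × S ↝[ suc k ] S′)
  pull′ S′⊆ with pull S′⊆
  ... | S , S⊆ , S↝S′ with ⊆-++⁻ (reverse (labels τ₁)) (⊆-trans S⊆ (⊆-reflexive lab))
  ... | S₁ , S₂ , refl , S₁⊆ , S₂⊆ =
    reverse S₁ ++ S₂ ,
    ⊆-trans (Sublist.++⁺ (subst (reverse S₁ ⊆ˡ_) (reverse-involutive (labels τ₁)) (Sublist.reverse⁺ S₁⊆)) S₂⊆) sub ,
    flip-prefix (reverse S₁) (subst (λ s → s ++ S₂ ↝[ k ] _) (sym (reverse-involutive S₁)) S↝S′)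

tail-tok-injective : ∀ c d {p q : List Bit} →
  (replicate c 0F ++ 0F ∷ 1F ∷ []) ++ p ≡ (replicate d 0F ++ 0F ∷ 1F ∷ []) ++ q → c ≡ d × p ≡ q
tail-tok-injective zero    zero    refl = refl , refl
tail-tok-injective (suc c) (suc d) eq = map₁ (cong suc) (tail-tok-injective c d (∷-injectiveʳ eq))
tail-tok-injective zero    (suc zero)    ()
tail-tok-injective zero    (suc (suc _)) ()
tail-tok-injective (suc zero)    zero    ()
tail-tok-injective (suc (suc _)) zero    ()

-- Surviving words land on words of the target.

module Alignment {A B : Set} (u : A → ℕ) (v : B → ℕ) where
  open Parse u

  -- `Q` pairs each intact word with the target word on which it lands. The sublist relation records
  -- that no occurrence of a target word is used twice, which the counting needs, and that the order
  -- is kept, which makes `Q` sorted by target block.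
  Aligned : List (A ⊎ Bit) → List B → Set
  Aligned τ σ = Σ[ Q ∈ List (A × B) ] (map proj₁ Q ≡ labels τ × map proj₂ Q ⊆ˡ σ × All (λ (x , y) → u x ≡ v y) Q)

  private
    skip-word : ∀ {τ s σ} → Aligned τ σ → Aligned τ (s ∷ σ)
    skip-word (Q , eq , sub , col) = Q , eq , _ ∷ʳ sub , col

  -- The word tok c = 1 0ᶜ⁺¹ 1 contains 10 only at its start, so it cannot occur
  -- elsewhere than at the start of a word.  The three cases are: between two words,
  -- inside the zeros of a word, and before the last letter of a word.
  align : ∀ τ σ → expand τ ≡ concatMap (tok ∘ v) σ → Aligned τ σ
  align-zeros : ∀ c τ σ → expand τ ≡ (replicate c 0F ++ 0F ∷ 1F ∷ []) ++ concatMap (tok ∘ v) σ → Aligned τ σ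
  align-last : ∀ τ σ → expand τ ≡ 1F ∷ concatMap (tok ∘ v) σ → Aligned τ σ

  align []           σ        eq = [] , refl , minimum σ , []
  align (inj₂ b ∷ τ) (s ∷ σ)  eq = skip-word {τ} (align-zeros (v s) τ σ (∷-injectiveʳ eq))
  align (inj₁ x ∷ τ) (s ∷ σ)  eq with tail-tok-injective (u x) (v s) (∷-injectiveʳ eq)
  ... | u≡v , eq′ with align τ σ eq′
  ... | Q , Q≡ , sub , col = (x , s) ∷ Q , cong (x ∷_) Q≡ , refl ∷ sub , u≡v ∷ col

  align-zeros zero    (inj₂ b ∷ τ) σ eq = align-last τ σ (∷-injectiveʳ eq)
  align-zeros (suc c) (inj₂ b ∷ τ) σ eq = align-zeros c τ σ (∷-injectiveʳ eq)
  align-zeros zero    (inj₁ x ∷ τ) σ ()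
  align-zeros (suc c) (inj₁ x ∷ τ) σ ()
  align-zeros zero    [] σ ()
  align-zeros (suc c) [] σ ()

  align-last (inj₂ b ∷ τ) σ eq = align τ σ (∷-injectiveʳ eq)
  align-last (inj₁ x ∷ τ) σ eq with u x | ∷-injectiveʳ eq
  align-last (inj₁ x ∷ τ) []      _ | zero  | ()
  align-last (inj₁ x ∷ τ) []      _ | suc _ | ()
  align-last (inj₁ x ∷ τ) (s ∷ σ) _ | zero  | ()
  align-last (inj₁ x ∷ τ) (s ∷ σ) _ | suc _ | ()

-- Sorted lists, and counting entries of block lists.

AllPairs-resp-⊆ : ∀ {R : A → A → Set} {xs ys} → xs ⊆ˡ ys → AllPairs R ys → AllPairs R xs
AllPairs-resp-⊆ []           []         = []
AllPairs-resp-⊆ (_ ∷ʳ sub)   (_ ∷ prs)  = AllPairs-resp-⊆ sub prs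
AllPairs-resp-⊆ (refl ∷ sub) (pr ∷ prs) = Sublist.All-resp-⊆ sub pr ∷ AllPairs-resp-⊆ sub prs

-- Strictness on `xs` means that once an entry of `ys` is matched or passed over, no later element
-- of `xs` can equal it. Ties in `ys` are therefore harmless; this is what allows one representative
-- per block to be picked.
sorted-∈⇒⊆ : ∀ (key : A → ℕ) {xs ys} → AllPairs (λ x y → key x < key y) xs → AllPairs (λ x y → key x ≤ key y) ys →
             All (_∈ˡ ys) xs → xs ⊆ˡ ys
sorted-∈⇒⊆ key [] _ _ = minimum _
sorted-∈⇒⊆ key {x ∷ xs} {y ∷ ys} (x< ∷ xs<) (y≤ ∷ ys≤) (here refl ∷ xs∈) =
  refl ∷ sorted-∈⇒⊆ key xs< ys≤ (All.zipWith (λ { (x<x′ , here refl) → contradiction x<x′ (<-irrefl refl) ; (_ , there x∈) → x∈ }) (x< , xs∈))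
sorted-∈⇒⊆ key {x ∷ xs} {y ∷ ys} (x< ∷ xs<) (y≤ ∷ ys≤) (there x∈ ∷ xs∈) =
  y ∷ʳ sorted-∈⇒⊆ key (x< ∷ xs<) ys≤
    (x∈ ∷ All.zipWith (λ { (x<y , here refl) → contradiction (All.lookup y≤ x∈) (<⇒≱ x<y) ; (_ , there x∈) → x∈ }) (x< , xs∈))

injective⇒surjective : (g : Fin n → Fin n) → (∀ {i j} → g i ≡ g j → i ≡ j) → ∀ i → ∃[ j ] g j ≡ i
injective⇒surjective {n} g inj i with F.any? (λ j → g j F.≟ i)
... | yes found = found
-- If `i` were missed, adding it as one more value would make `g` an injection from n + 1 elements
-- into n.
... | no ¬found with F.pigeonhole (n<1+n n) (λ { F.zero → i ; (F.suc j) → g j })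
... | F.zero  , F.suc j , _   , eq = contradiction (j , sym eq) ¬found
... | F.suc k , F.suc j , k<j , eq = contradiction (cong F.suc (inj eq)) (F.<⇒≢ k<j)

weight : Subset n → List (Fin n) → ℕ
weight P = length ∘ filter (T? ∘ Vec.lookup P)

weight-⊆ : ∀ (P : Subset n) {xs ys} → xs ⊆ˡ ys → weight P xs ≤ weight P ys
weight-⊆ P sub = Sublist.length-mono-≤ (Sublist.filter⁺ (T? ∘ Vec.lookup P) (T? ∘ Vec.lookup P) (λ { refl t → t }) sub)

weight-++ : ∀ (P : Subset n) xs ys → weight P (xs ++ ys) ≡ weight P xs + weight P ys
weight-++ P xs ys = trans (cong length (filter-++ (T? ∘ Vec.lookup P) xs ys)) (length-++ (filter (T? ∘ Vec.lookup P) xs))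

weight-∁ : ∀ (P : Subset n) xs → length xs ≡ weight P xs + weight (∁ P) xs
weight-∁ P []       = refl
weight-∁ P (x ∷ xs) with Vec.lookup P x | Vec.lookup (∁ P) x | Vec.lookup-map x not P
... | true  | .false | refl = cong suc (weight-∁ P xs)
... | false | .true  | refl = trans (cong suc (weight-∁ P xs)) (sym (+-suc _ _))

weight-blocks : ∀ M (P : Subset n) xs → weight P (blocks M xs) ≡ M * weight P xs
weight-blocks M P []       = sym (*-zeroʳ M)
weight-blocks M P (x ∷ xs) = begin
  weight P (replicate M x ++ blocks M xs)          ≡⟨ weight-++ P (replicate M x) (blocks M xs) ⟩
  weight P (replicate M x) + weight P (blocks M xs) ≡⟨ cong₂ _+_ (weight-replicate M) (weight-blocks M P xs) ⟩
  M * weight P [ x ] + M * weight P xs             ≡⟨ *-distribˡ-+ M (weight P [ x ]) (weight P xs) ⟨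
  M * (weight P [ x ] + weight P xs)               ≡⟨ cong (M *_) (weight-++ P [ x ] xs) ⟨
  M * weight P (x ∷ xs)                            ∎
  where
  open ≡-Reasoning
  weight-replicate : ∀ M → weight P (replicate M x) ≡ M * weight P [ x ]
  weight-replicate zero    = refl
  weight-replicate (suc M) = trans (weight-++ P [ x ] (replicate M x)) (cong (weight P [ x ] +_) (weight-replicate M))

weight-allFin : (P : Subset n) → weight P (allFin n) ≡ ∣ P ∣
weight-allFin [] = refl
weight-allFin {suc n} (b ∷ P) = trans (cong (weight (b ∷ P) ∘ (F.zero ∷_)) (sym (map-tabulate (λ i → i) F.suc))) (head b)
  where
  weight-map-suc : ∀ b xs → weight (b ∷ P) (map F.suc xs) ≡ weight P xs
  weight-map-suc b [] = refl
  weight-map-suc b (x ∷ xs) with Vec.lookup P x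
  ... | true  = cong suc (weight-map-suc b xs)
  ... | false = weight-map-suc b xs
  head : ∀ b → weight (b ∷ P) (F.zero ∷ map F.suc (allFin n)) ≡ ∣ b ∷ P ∣
  head true  = cong suc (trans (weight-map-suc true (allFin n)) (weight-allFin P))
  head false = trans (weight-map-suc false (allFin n)) (weight-allFin P)

weight-proj : ∀ {m} (P : Subset m) (R : Subset n) (Q : List (Fin m × Fin n)) →
              (∀ {x y} → (x , y) ∈ˡ Q → y ∈ R → x ∈ P) → weight R (map proj₂ Q) ≤ weight P (map proj₁ Q)
weight-proj P R [] _ = z≤n
weight-proj P R ((x , y) ∷ Q) R⇒P
  with Vec.lookup R y in y∈ | Vec.lookup P x in x∈ | weight-proj P R Q (λ q∈ → R⇒P (there q∈))
... | true  | true  | rec = s≤s rec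
... | false | true  | rec = m≤n⇒m≤1+n rec
... | false | false | rec = rec
... | true  | false | _   =
  contradiction (trans (sym x∈) (Vec.[]=⇒lookup (R⇒P (here refl) (Vec.lookup⇒[]= y R y∈)))) λ ()

-- From surviving words to flips of the original string.

module Matched {n M j : ℕ} (j<M : j < M) (Q : List (Fin n × Fin n)) where

  open import Data.List.Membership.DecPropositional (×-≡-dec (F._≟_ {n}) (F._≟_ {n})) using () renaming (_∈?_ to _∈ˡ?_)
  -- The target blocks are the vertices to be matched: `g` will name, for each position of Y, the
  -- position of X that supplies its symbol.
  private module H = Hall (λ y x → (x , y) ∈ˡ? Q) (λ y → y)

  transversal : map proj₂ Q ⊆ˡ blocks M (allFin n) →
                (∀ P → weight P (map proj₁ Q) ≤ M * ∣ P ∣) →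
                M * n ≤ j + length Q →
                Σ[ g ∈ (Fin n → Fin n) ] ((∀ y → (g y , y) ∈ˡ Q) × (∀ {y z} → g y ≡ g z → y ≡ z))
  transversal sub w≤ len with H.matching n ⊤ ⊤ (≤-reflexive (∣⊤∣≡n n)) cond
    where
    cond : H.Condition ⊤ ⊤
    -- The lower bound on uncut words concerns all of `Q`, so `M * ∣ ∁ R ∣`, the capacity of the
    -- remaining target blocks, is carried on both sides and cancelled. Using `j < M` gives
    -- `M * ∣ R ∣ < M * suc ∣ N ∣`, and dividing by `M` absorbs the loss of `j` words.
    cond R _ = ≤-trans (s≤s⁻¹ (*-cancelˡ-< M _ _ (+-cancelʳ-< (M * ∣ ∁ R ∣) _ _ (begin-strict
      M * ∣ R ∣ + M * ∣ ∁ R ∣                  ≡⟨ *-distribˡ-+ M ∣ R ∣ ∣ ∁ R ∣ ⟨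
      M * (∣ R ∣ + ∣ ∁ R ∣)                    ≡⟨ cong (M *_) (trans (cong (∣ R ∣ +_) (∣∁p∣≡n∸∣p∣ R)) (m+[n∸m]≡n (∣p∣≤n R))) ⟩
      M * n                                  ≤⟨ len ⟩
      j + length Q                           ≡⟨ cong (j +_) (trans (sym (length-map proj₂ Q)) (weight-∁ R (map proj₂ Q))) ⟩
      j + (weight R (map proj₂ Q) + weight (∁ R) (map proj₂ Q))
        ≤⟨ +-monoʳ-≤ j (+-mono-≤ (≤-trans (weight-proj N R Q λ q∈ y∈ → H.∈neighbours⁺ R y∈ q∈) (w≤ N)) (weight-∁R)) ⟩
      j + (M * ∣ N ∣ + M * ∣ ∁ R ∣)            <⟨ +-monoˡ-< _ j<M ⟩
      M + (M * ∣ N ∣ + M * ∣ ∁ R ∣)            ≡⟨ +-assoc M _ _ ⟨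
      M + M * ∣ N ∣ + M * ∣ ∁ R ∣              ≡⟨ cong (_+ M * ∣ ∁ R ∣) (*-suc M ∣ N ∣) ⟨
      M * suc ∣ N ∣ + M * ∣ ∁ R ∣              ∎))))
      (p⊆q⇒∣p∣≤∣q∣ {p = H.neighbours R} λ x∈ → x∈p∩q⁺ (x∈ , ∈⊤))
      where
      open ≤-Reasoning
      N = H.neighbours R
      weight-∁R : weight (∁ R) (map proj₂ Q) ≤ M * ∣ ∁ R ∣
      weight-∁R = ≤-trans (weight-⊆ (∁ R) sub)
        (≤-reflexive (trans (weight-blocks M (∁ R) (allFin n)) (cong (M *_) (weight-allFin (∁ R)))))
  ... | g , g∈ , g-inj = g , (λ y → proj₂ (g∈ ∈⊤)) , g-inj ∈⊤ ∈⊤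

module LowerBound {n M j : ℕ} (u v : Fin n → Fin a) (j<M : j < M) where

  open Parse (toℕ ∘ u) using (expand)
  open Alignment (toℕ ∘ u) (toℕ ∘ v)

  private
    B₀ = blocks M (allFin n)

    B₀-sorted : AllPairs F._≤_ B₀
    B₀-sorted = go (allFin n) (AllPairs.tabulate⁺-< <⇒≤)
      where
      replicate-sorted : ∀ k x → AllPairs {A = Fin n} F._≤_ (replicate k x)
      replicate-sorted zero    x = []
      replicate-sorted (suc k) x = All.replicate⁺ k ≤-refl ∷ replicate-sorted k x
      All-blocks : ∀ {P : Fin n → Set} {xs} → All P xs → All P (blocks M xs)
      All-blocks []       = []
      All-blocks (p ∷ ps) = All.++⁺ (All.replicate⁺ M p) (All-blocks ps)
      go : ∀ (xs : List (Fin n)) → AllPairs F._≤_ xs → AllPairs F._≤_ (blocks M xs)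
      go []       []         = []
      go (x ∷ xs) (x≤ ∷ xs≤) =
        AllPairs.++⁺ (replicate-sorted M x) (go xs xs≤) (All.replicate⁺ M (All-blocks x≤))

    length-B₀ : length B₀ ≡ M * n
    length-B₀ = go (allFin n) (length-tabulate (λ i → i))
      where
      go : ∀ (xs : List (Fin n)) {m} → length xs ≡ m → length (blocks M xs) ≡ M * m
      go []       refl = sym (*-zeroʳ M)
      go (x ∷ xs) refl = trans (length-++ (replicate M x)) (trans (cong₂ _+_ (length-replicate M) (go xs refl)) (sym (*-suc M (length xs))))

  lower-bound : Flips j (enc M (map u (allFin n))) (enc M (map v (allFin n))) →
                map u (allFin n) ↝[ j ] map v (allFin n)
  lower-bound fl with track (toℕ ∘ u) fl (map inj₁ B₀) (trans (enc-map M u (allFin n)) (sym (concatMap-map _ inj₁ B₀)))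
  ... | τ , y≡ , len , pull with align τ B₀ (trans (sym y≡) (enc-map M v (allFin n)))
  ... | Q , Q≡ , sub , col with Matched.transversal j<M Q sub w≤ len′
    where
    w≤ : ∀ P → weight P (map proj₁ Q) ≤ M * ∣ P ∣
    -- Pulling back all surviving labels at once shows them to be a permutation of a sublist of
    -- `B₀`, so no source block contributes more than M.
    w≤ P with pull ⊆-refl
    ... | S , S⊆ , _ , _ , S↝ = begin
      weight P (map proj₁ Q)  ≡⟨ cong (weight P) Q≡ ⟩
      weight P (labels τ)     ≡⟨ ↭-length (filter-↭ (T? ∘ Vec.lookup P) (Flips-↭ S↝)) ⟨
      weight P S              ≤⟨ weight-⊆ P (subst (S ⊆ˡ_) (labels-map-inj₁ B₀) S⊆) ⟩
      weight P B₀             ≡⟨ weight-blocks M P (allFin n) ⟩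
      M * weight P (allFin n) ≡⟨ cong (M *_) (weight-allFin P) ⟩
      M * ∣ P ∣               ∎
      where open ≤-Reasoning
    len′ : M * n ≤ j + length Q
    len′ = subst₂ (λ l r → l ≤ j + r) (trans (cong length (labels-map-inj₁ B₀)) length-B₀)
             (trans (cong length (sym Q≡)) (length-map proj₁ Q)) len
  ... | g , g∈ , g-inj with pull (subst₂ _⊆ˡ_ (sym (map-∘ (allFin n))) Q≡ (Sublist.map⁺ proj₁ Q′⊆Q))
    where
    Q-sorted : AllPairs (λ p q → proj₂ p F.≤ proj₂ q) Q
    Q-sorted = AllPairs.map⁻ (AllPairs-resp-⊆ sub B₀-sorted)
    Q′⊆Q : map (λ y → g y , y) (allFin n) ⊆ˡ Q
    -- `Q` is sorted by its second components and the chosen pairs have strictly increasing ones, so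
    -- membership of each pair suffices.
    Q′⊆Q = sorted-∈⇒⊆ (toℕ ∘ proj₂) (AllPairs.map⁺ (AllPairs.tabulate⁺-< (λ lt → lt))) Q-sorted
             (All.map⁺ (All.tabulate⁺ g∈))
  ... | S , S⊆ , j′ , j′≤j , S↝ =
    ↝-weaken j′≤j (subst₂ (_↝[ j′ ]_) (cong (map u) S≡) map-u∘g
      (Flips-lift (map u) (map-++ u) (λ s → reverse-map u s) S↝))
    where
    S-sorted : AllPairs F._≤_ S
    S-sorted = AllPairs-resp-⊆ (subst (S ⊆ˡ_) (labels-map-inj₁ B₀) S⊆) B₀-sorted
    ∈S : ∀ i → i ∈ˡ S
    ∈S i with injective⇒surjective g g-inj i
    ... | y , refl = ∈-resp-↭ (↭-sym (Flips-↭ S↝)) (∈-map⁺ g (∈-allFin y))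
    allFin⊆S : allFin n ⊆ˡ S
    allFin⊆S = sorted-∈⇒⊆ toℕ (AllPairs.tabulate⁺-< (λ lt → lt)) S-sorted (All.tabulate⁺ ∈S)
    -- The chosen words started in the order of X: `S` is sorted as a sublist of `B₀`, contains
    -- every position because `g` is onto, and has length n.
    S≡ : S ≡ allFin n
    S≡ = sym (Pointwise-≡⇒≡ (toPointwise (sym (trans (↭-length (Flips-↭ S↝)) (length-map g (allFin n)))) allFin⊆S))
    map-u∘g : map u (map g (allFin n)) ≡ map v (allFin n)
    map-u∘g = trans (sym (map-∘ (allFin n))) (map-cong (λ y → F.toℕ-injective (All.lookup col (g∈ y))) (allFin n))

-- The encoder as a stack program and its running time.

Within : Program k → Store k → ℕ → Store k → Set
Within P σ T τ = ∃[ t ] (t ≤ T × Runs P σ t τ)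

infixr 5 _⨟_

_⨟_ : ∀ {P Q : Program k} {σ ρ τ T U} → Within P σ T ρ → Within Q ρ U τ → Within (P ⨾ Q) σ (T + U) τ
(t , t≤T , r) ⨟ (u , u≤U , s) = t + u , +-mono-≤ t≤T u≤U , seq r s

within-push : ∀ {σ : Store k} {i b} → Within (push i b) σ 1 (σ [ i ]≔ (b ∷ lookup σ i))
within-push = 1 , ≤-refl , push

drain : Fin k → (Bit → Program k) → Program k
drain i body = while i (pop i skip body)

module _ {k} {i : Fin k} {body : Bit → Program k} {T : ℕ} {A : Set}
         (S : List Bit → A → Store k) (next : A → Bit → A) (Inv : List Bit → A → Set)
         (lookup-S : ∀ xs s → lookup (S xs s) i ≡ xs)
         (run-body : ∀ b xs s → Inv (b ∷ xs) s →
                     Inv xs (next s b) × Within (body b) (S (b ∷ xs) s [ i ]≔ xs) T (S xs (next s b))) where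

  -- A loop rule in which `s` abstracts the stacks other than `i`, so that the effect of the loop is
  -- a `foldl`. Each pass pays one unit for the test and one for the pop, whence `2 + T`; the outer
  -- `suc` pays for the final test.
  within-drain : ∀ {l} xs s → Inv xs s → length xs ≤ l →
                 Within (drain i body) (S xs s) (suc (l * (2 + T))) (S [] (foldl next s xs))
  within-drain []       s inv _ = 1 , s≤s z≤n , while-done (lookup-S [] s)
  within-drain {suc l} (b ∷ xs) s inv (s≤s len) with run-body b xs s inv
  ... | inv′ , t , t≤T , r with within-drain xs (next s b) inv′ len
  ... | u , u≤ , rs =
    suc (suc t + u) ,
    s≤s (≤-trans (s≤s (+-mono-≤ t≤T u≤)) (≤-reflexive (cong suc (+-suc T _)))) ,
    while-step (lookup-S (b ∷ xs) s) (pop-bit (lookup-S (b ∷ xs) s) r) rs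

-- Stacks: 0, 1 hold the strings, 2 and 3 the number of copies of each word, 4 and 5
-- the symbol being read, 6 the input and 7 the reversed output of the encoder.
store : (x y m m′ c c′ i o : List Bit) → Store 8
store x y m m′ c c′ i o = x ∷ y ∷ m ∷ m′ ∷ c ∷ c′ ∷ i ∷ o ∷ []

unary : ℕ → List Bit
unary c = replicate c 1F

move : Fin k → Fin k → Program k
move i j = drain i (push j)

-- Reading a unary counter destroys it, so counters 4 and 2 are copied to 5 and 3 during their loops
-- and moved back for the next use. After all copies of a word are written, `emit` clears 4 for the
-- next symbol.
zeros emitWord emit encoder : Program 8
zeros    = drain 4F (λ _ → push 5F 1F ⨾ push 7F 0F) ⨾ move 5F 4F
emitWord = push 7F 1F ⨾ push 7F 0F ⨾ zeros ⨾ push 7F 1F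
emit     = drain 2F (λ _ → push 3F 1F ⨾ emitWord) ⨾ move 3F 2F ⨾ drain 4F (λ _ → skip)

readBit : Bit → Program 8
readBit 0F = emit
readBit 1F = push 4F 1F

encoder = drain 6F readBit

reduction : Program 8
reduction =
  -- The pass over X also leaves two marks per bit on stack 2, the number of copies. A move reverses
  -- a stack, so each input goes through 7 to reach 6 in its original order, and the reversed output
  -- is put right by a final move.
  drain 0F (λ b → push 7F b ⨾ push 2F 1F ⨾ push 2F 1F) ⨾ move 7F 6F ⨾ encoder ⨾ move 7F 0F ⨾
  move 1F 7F ⨾ move 7F 6F ⨾ encoder ⨾ move 7F 1F

within-move : ∀ {i j : Fin k} (S : List Bit → List Bit → Store k) →
  (∀ xs ys → lookup (S xs ys) i ≡ xs) →
  (∀ b xs ys → let σ = S (b ∷ xs) ys [ i ]≔ xs in σ [ j ]≔ (b ∷ lookup σ j) ≡ S xs (b ∷ ys)) →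
  ∀ {l xs ys} → reverse xs ≡ ys → length ys ≤ l → Within (move i j) (S xs []) (suc (l * 3)) (S [] ys)
within-move {j = j} S lookup-S push-S {xs = xs} refl len =
  within-drain S (flip _∷_) (λ _ _ → Unit) lookup-S
    (λ b xs ys _ → tt , subst (Within (push j b) _ 1) (push-S b xs ys) within-push)
    xs [] tt (≤-trans (≤-reflexive (sym (length-reverse xs))) len)

zerosTime emitWordTime : ℕ → ℕ
zerosTime L    = suc (L * 4) + suc (L * 3)
emitWordTime L = 1 + (1 + (zerosTime L + 1))

emitTime : ℕ → ℕ → ℕ
emitTime L M = suc (M * (2 + (1 + emitWordTime L))) + (suc (M * 3) + suc (L * 3))

encoderTime : ℕ → ℕ → ℕ
encoderTime L M = suc (L * (2 + emitTime L M))

emitted : ℕ → ℕ → List Bit → List Bit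
emitted M c o = concatMap tok (replicate M c) ++ o

module _ {x y i : List Bit} where

  within-zeros : ∀ {L m m′ o} c → c ≤ L →
    Within zeros (store x y m m′ (unary c) [] i o) (zerosTime L) (store x y m m′ (unary c) [] i (replicate c 0F ++ o))
  within-zeros {L} {m} {m′} {o} c c≤L =
    subst (λ s → Within (drain 4F (λ _ → push 5F 1F ⨾ push 7F 0F)) (S (unary c) (0 , o)) (suc (L * 4)) (S [] s)) (foldl-next c)
      (within-drain S next (λ _ _ → Unit) (λ _ _ → refl) (λ _ _ _ _ → tt , (within-push ⨟ within-push))
        (unary c) (0 , o) tt (≤-trans (≤-reflexive (length-replicate c)) c≤L))
    ⨟ within-move (λ xs ys → store x y m m′ ys xs i (replicate c 0F ++ o)) (λ _ _ → refl) (λ _ _ _ → refl)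
        (trans (cong (reverse ∘ unary) (+-identityʳ c)) (reverse-replicate c 1F))
        (≤-trans (≤-reflexive (length-replicate c)) c≤L)
    where
    S : List Bit → ℕ × List Bit → Store 8
    S xs (c′ , o) = store x y m m′ xs (unary c′) i o
    next : ℕ × List Bit → Bit → ℕ × List Bit
    next (c′ , o) _ = suc c′ , 0F ∷ o
    foldl-next : ∀ d {c′ o} → foldl next (c′ , o) (unary d) ≡ (d + c′ , replicate d 0F ++ o)
    foldl-next zero    = refl
    foldl-next (suc d) {c′} {o} = trans (foldl-next d) (cong₂ _,_ (+-suc d c′) (replicate-++ d 0F o))

  within-emitWord : ∀ {L m m′ o} c → c ≤ L →
    Within emitWord (store x y m m′ (unary c) [] i o) (emitWordTime L) (store x y m m′ (unary c) [] i (tok c ++ o))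
  within-emitWord {L} {m} {m′} {o} c c≤L =
    subst (λ w → Within emitWord (store x y m m′ (unary c) [] i o) (emitWordTime L) (store x y m m′ (unary c) [] i (1F ∷ w)))
      (sym (++-assoc (replicate c 0F) (0F ∷ 1F ∷ []) o))
      (within-push ⨟ within-push ⨟ within-zeros c c≤L ⨟ within-push)

  within-emit : ∀ {L M o} c → c ≤ L →
    Within emit (store x y (unary M) [] (unary c) [] i o) (emitTime L M) (store x y (unary M) [] [] [] i (emitted M c o))
  within-emit {L} {M} {o} c c≤L =
    subst (λ s → Within (drain 2F (λ _ → push 3F 1F ⨾ emitWord)) (S (unary M) (0 , o)) (suc (M * (2 + (1 + emitWordTime L)))) (S [] s)) (foldl-next M)
      (within-drain S next (λ _ _ → Unit) (λ _ _ → refl) (λ _ _ _ _ → tt , (within-push ⨟ within-emitWord c c≤L))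
        (unary M) (0 , o) tt (≤-reflexive (length-replicate M)))
    ⨟ within-move (λ xs ys → store x y ys xs (unary c) [] i (emitted M c o)) (λ _ _ → refl) (λ _ _ _ → refl)
        (trans (cong (reverse ∘ unary) (+-identityʳ M)) (reverse-replicate M 1F)) (≤-reflexive (length-replicate M))
    ⨟ within-drain (λ xs (_ : Unit) → store x y (unary M) [] xs [] i (emitted M c o)) (λ _ _ → tt) (λ _ _ → Unit)
        (λ _ _ → refl) (λ _ _ _ _ → tt , 1 , ≤-refl , skip) (unary c) tt tt (≤-trans (≤-reflexive (length-replicate c)) c≤L)
    where
    S : List Bit → ℕ × List Bit → Store 8
    S xs (m , o) = store x y xs (unary m) (unary c) [] i o
    next : ℕ × List Bit → Bit → ℕ × List Bit
    next (m , o) _ = suc m , tok c ++ o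
    foldl-next : ∀ d {m o} → foldl next (m , o) (unary d) ≡ (d + m , emitted d c o)
    foldl-next zero    = refl
    foldl-next (suc d) {m} {o} = trans (foldl-next d) (cong₂ _,_ (+-suc d m) (shift d))
      where
      shift : ∀ d → emitted d c (tok c ++ o) ≡ emitted (suc d) c o
      shift zero    = cong (_++ o) (sym (++-identityʳ (tok c)))
      shift (suc d) = trans (++-assoc (tok c) (concatMap tok (replicate d c)) (tok c ++ o))
        (trans (cong (tok c ++_) (shift d)) (sym (++-assoc (tok c) (concatMap tok (replicate (suc d) c)) o)))

readNext : ℕ → ℕ × List Bit → Bit → ℕ × List Bit
readNext M (c , o) 0F = 0 , emitted M c o
readNext M (c , o) 1F = suc c , o

-- The output stack collects the blocks in reverse order, and reversing it restores that order but
-- also reverses each block. Since the blocks are palindromes, the result is the encoding itself.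
foldl-readNext : ∀ M (X : String a) o →
  ∃[ o′ ] (foldl (readNext M) (0 , o) (encode X) ≡ (0 , o′) × reverse o′ ≡ reverse o ++ enc M X)
foldl-readNext M [] o = o , refl , sym (++-identityʳ (reverse o))
foldl-readNext {a} M (s ∷ X) o with foldl-readNext M X (emitted M (toℕ s) o)
... | o′ , eq , rev = o′ , trans (symbol (toℕ s) 0) (trans (cong (λ c → foldl (readNext M) (0 , emitted M c o) (encode X)) (+-identityʳ (toℕ s))) eq) ,
  (begin
    reverse o′                                              ≡⟨ rev ⟩
    reverse (emitted M (toℕ s) o) ++ enc M X                ≡⟨ cong (_++ enc M X) (reverse-++ w o) ⟩
    (reverse o ++ reverse w) ++ enc M X                     ≡⟨ cong (λ w → (reverse o ++ w) ++ enc M X) w-palindrome ⟩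
    (reverse o ++ w) ++ enc M X                             ≡⟨ ++-assoc (reverse o) w (enc M X) ⟩
    reverse o ++ w ++ enc M X                               ≡⟨ cong (reverse o ++_) (concatMap-++ tok (replicate M (toℕ s)) _) ⟨
    reverse o ++ enc M (s ∷ X)                              ∎)
  where
  open ≡-Reasoning
  w = concatMap tok (replicate M (toℕ s))
  w-palindrome : reverse w ≡ w
  w-palindrome = trans (reverse-concatMap tok tok-palindrome (replicate M (toℕ s))) (cong (concatMap tok) (reverse-replicate M (toℕ s)))
  symbol : ∀ d c → foldl (readNext M) (c , o) ((replicate d 1F ++ [ 0F ]) ++ encode X) ≡
                   foldl (readNext M) (0 , emitted M (d + c) o) (encode X)
  symbol zero    c = refl
  symbol (suc d) c = trans (symbol d (suc c)) (cong (λ e → foldl (readNext M) (0 , emitted M e o) (encode X)) (+-suc d c))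

within-encoder : ∀ {x y L M} (X : String a) → length (encode X) ≤ L →
  ∃[ o ] (reverse o ≡ enc M X ×
          Within encoder (store x y (unary M) [] [] [] (encode X) []) (encoderTime L M) (store x y (unary M) [] [] [] [] o))
within-encoder {x = x} {y} {L} {M} X len with foldl-readNext M X []
... | o , eq , rev = o , rev ,
  subst (λ s → Within encoder (S (encode X) (0 , [])) (encoderTime L M) (S [] s)) eq
    -- Invariant: the counter plus the unread input stays within `L`. So the counter never exceeds
    -- `L`, and every call of `emit` fits into `emitTime L M`.
    (within-drain S (readNext M) (λ xs s → proj₁ s + length xs ≤ L) (λ _ _ → refl) body (encode X) (0 , []) len len)
  where
  S : List Bit → ℕ × List Bit → Store 8
  S xs (c , o) = store x y (unary M) [] (unary c) [] xs o
  body : ∀ b xs s → proj₁ s + length (b ∷ xs) ≤ L → (proj₁ (readNext M s b) + length xs ≤ L) ×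
         Within (readBit b) (S (b ∷ xs) s [ 6F ]≔ xs) (emitTime L M) (S xs (readNext M s b))
  body 0F xs (c , o) inv = ≤-trans (n≤1+n _) (m+n≤o⇒n≤o c inv) , within-emit c (m+n≤o⇒m≤o c inv)
  body 1F xs (c , o) inv = subst (_≤ L) (+-suc c (length xs)) inv , 1 , s≤s z≤n , push

reductionTime : ℕ → ℕ → ℕ → ℕ
reductionTime L M W =
  suc (L * 5) + (suc (L * 3) + (encoderTime L M + (suc (W * 3) + (suc (L * 3) + (suc (L * 3) + (encoderTime L M + suc (W * 3)))))))

-- The program sees the code and not n. Every symbol contributes at least its closing 0, so this is
-- at least `2 * length X`, hence at least the distance.
copies : String a → ℕ
copies X = length (encode X) * 2

within-reduction : ∀ {L W} (X Y : String a) (let M = copies X) →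
  length (encode X) ≤ L → length (encode Y) ≤ L → length (enc M X) ≤ W → length (enc M Y) ≤ W →
  Within reduction (store (encode X) (encode Y) [] [] [] [] [] []) (reductionTime L M W)
                   (store (enc M X) (enc M Y) (unary M) [] [] [] [] [])
within-reduction {L = L} {W} X Y lenX lenY lenX′ lenY′ with within-encoder {x = []} {encode Y} {L} {copies X} X lenX
... | o , o≡ , runX with within-encoder {x = enc (copies X) X} {[]} {L} {copies X} Y lenY
... | p , p≡ , runY =
    subst (λ s → Within load (S (encode X) ([] , 0)) (suc (L * 5)) (S [] s))
      (trans (foldl-next (encode X) [] 0) (cong (reverse (encode X) ,_) (+-identityʳ M)))
      (within-drain S next (λ _ _ → Unit) (λ _ _ → refl) (λ _ _ _ _ → tt , (within-push ⨟ within-push ⨟ within-push))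
        (encode X) ([] , 0) tt lenX)
  ⨟ within-move (λ xs ys → store [] (encode Y) (unary M) [] [] [] ys xs) (λ _ _ → refl) (λ _ _ _ → refl) (reverse-involutive (encode X)) lenX
  ⨟ runX
  ⨟ within-move (λ xs ys → store ys (encode Y) (unary M) [] [] [] [] xs) (λ _ _ → refl) (λ _ _ _ → refl) o≡ lenX′
  ⨟ within-move (λ xs ys → store (enc M X) xs (unary M) [] [] [] [] ys) (λ _ _ → refl) (λ _ _ _ → refl) refl
      (≤-trans (≤-reflexive (length-reverse (encode Y))) lenY)
  ⨟ within-move (λ xs ys → store (enc M X) [] (unary M) [] [] [] ys xs) (λ _ _ → refl) (λ _ _ _ → refl) (reverse-involutive (encode Y)) lenY
  ⨟ runY
  ⨟ within-move (λ xs ys → store (enc M X) ys (unary M) [] [] [] [] xs) (λ _ _ → refl) (λ _ _ _ → refl) p≡ lenY′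
  where
  M = copies X
  load : Program 8
  load = drain 0F (λ b → push 7F b ⨾ push 2F 1F ⨾ push 2F 1F)
  S : List Bit → List Bit × ℕ → Store 8
  S xs (o , m) = store xs (encode Y) (unary m) [] [] [] [] o
  next : List Bit × ℕ → Bit → List Bit × ℕ
  next (o , m) b = b ∷ o , 2 + m
  foldl-next : ∀ xs o m → foldl next (o , m) xs ≡ (foldl (flip _∷_) o xs , length xs * 2 + m)
  foldl-next []       o m = refl
  foldl-next (x ∷ xs) o m = trans (foldl-next xs (x ∷ o) (2 + m))
    (cong (foldl (flip _∷_) (x ∷ o) xs ,_) (trans (+-suc (length xs * 2) (suc m)) (cong suc (+-suc (length xs * 2) m))))

-- Polynomial bounds on time and size.

-- Bounds c · (n + 1)ᵉ are closed under sums and products without lower-order terms.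
SucPolynomial : (ℕ → ℕ) → Set
SucPolynomial f = ∃[ c ] ∃[ e ] (∀ n → f n ≤ c * suc n ^ e)

const-poly : ∀ c → SucPolynomial (λ _ → c)
const-poly c = c , 0 , λ _ → ≤-reflexive (sym (*-identityʳ c))

id-poly : SucPolynomial (λ n → n)
id-poly = 1 , 1 , λ n → ≤-trans (n≤1+n n) (≤-reflexive (sym (trans (*-identityˡ _) (*-identityʳ (suc n)))))

infixl 6 _+ᵖ_
infixl 7 _*ᵖ_

_+ᵖ_ : ∀ {f g} → SucPolynomial f → SucPolynomial g → SucPolynomial (λ n → f n + g n)
(c , e , f≤) +ᵖ (d , e′ , g≤) = c + d , e + e′ , λ n → ≤-trans
  (+-mono-≤ (≤-trans (f≤ n) (*-monoʳ-≤ c (^-monoʳ-≤ (suc n) (m≤m+n e e′))))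
            (≤-trans (g≤ n) (*-monoʳ-≤ d (^-monoʳ-≤ (suc n) (m≤n+m e′ e)))))
  (≤-reflexive (sym (*-distribʳ-+ (suc n ^ (e + e′)) c d)))

_*ᵖ_ : ∀ {f g} → SucPolynomial f → SucPolynomial g → SucPolynomial (λ n → f n * g n)
(c , e , f≤) *ᵖ (d , e′ , g≤) = c * d , e + e′ , λ n → ≤-trans (*-mono-≤ (f≤ n) (g≤ n))
  (≤-reflexive (trans ([m*n]*[o*p]≡[m*o]*[n*p] c (suc n ^ e) d (suc n ^ e′)) (cong (c * d *_) (sym (^-distribˡ-+-* (suc n) e e′)))))

^-distribʳ-* : ∀ e m n → (m * n) ^ e ≡ m ^ e * n ^ e
^-distribʳ-* zero    m n = refl
^-distribʳ-* (suc e) m n = trans (cong (m * n *_) (^-distribʳ-* e m n)) ([m*n]*[o*p]≡[m*o]*[n*p] m n (m ^ e) (n ^ e))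

-- For n ≥ 1 the estimate n + 1 ≤ 2n costs a factor 2ᵉ; the additive constant takes care of n = 0.
SucPolynomial⇒PolynomiallyBounded : ∀ {f} → SucPolynomial f → PolynomiallyBounded f
SucPolynomial⇒PolynomiallyBounded {f} (c , e , f≤) = c * 2 ^ e , e , λ n → ≤-trans (f≤ n) (bound n)
  where
  open ≤-Reasoning
  bound : ∀ n → c * suc n ^ e ≤ c * 2 ^ e * n ^ e + c * 2 ^ e
  bound zero = ≤-trans (*-monoʳ-≤ c (^-monoˡ-≤ e (s≤s (z≤n {1})))) (m≤n+m (c * 2 ^ e) _)
  bound n@(suc k) = begin
    c * suc n ^ e             ≤⟨ *-monoʳ-≤ c (^-monoˡ-≤ e 1+n≤2n) ⟩
    c * (2 * n) ^ e           ≡⟨ cong (c *_) (^-distribʳ-* e 2 n) ⟩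
    c * (2 ^ e * n ^ e)       ≡⟨ *-assoc c (2 ^ e) (n ^ e) ⟨
    c * 2 ^ e * n ^ e         ≤⟨ m≤m+n _ _ ⟩
    c * 2 ^ e * n ^ e + c * 2 ^ e ∎
    where
    1+n≤2n : suc n ≤ 2 * n
    1+n≤2n = s≤s (≤-trans (s≤s (m≤m+n k (k + 0))) (≤-reflexive (sym (+-suc k (k + 0)))))

lengthBound copiesBound sizeBound timeBound : ℕ → ℕ
lengthBound n = n * n
copiesBound n = lengthBound n * 2
sizeBound n   = n * (copiesBound n * (2 + n))
timeBound n   = reductionTime (lengthBound n) (copiesBound n) (sizeBound n)

copiesBound-poly : SucPolynomial copiesBound
copiesBound-poly = id-poly *ᵖ id-poly *ᵖ const-poly 2

sizeBound-poly : SucPolynomial sizeBound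
sizeBound-poly = id-poly *ᵖ (copiesBound-poly *ᵖ (const-poly 2 +ᵖ id-poly))

timeBound-poly : SucPolynomial timeBound
timeBound-poly =
  const-poly 1 +ᵖ L *ᵖ const-poly 5 +ᵖ (const-poly 1 +ᵖ L *ᵖ const-poly 3 +ᵖ (encoderᵖ +ᵖ (const-poly 1 +ᵖ W *ᵖ const-poly 3 +ᵖ
    (const-poly 1 +ᵖ L *ᵖ const-poly 3 +ᵖ (const-poly 1 +ᵖ L *ᵖ const-poly 3 +ᵖ (encoderᵖ +ᵖ (const-poly 1 +ᵖ W *ᵖ const-poly 3)))))))
  where
  L : SucPolynomial lengthBound
  L = id-poly *ᵖ id-poly
  M = copiesBound-poly
  W = sizeBound-poly
  zerosᵖ : SucPolynomial (λ n → zerosTime (lengthBound n))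
  zerosᵖ = const-poly 1 +ᵖ L *ᵖ const-poly 4 +ᵖ (const-poly 1 +ᵖ L *ᵖ const-poly 3)
  encoderᵖ : SucPolynomial (λ n → encoderTime (lengthBound n) (copiesBound n))
  encoderᵖ = const-poly 1 +ᵖ L *ᵖ (const-poly 2 +ᵖ
    -- The 5 collects the test and the pop of a pass, the push onto stack 3 and the first two pushes
    -- of `emitWord`.
    (const-poly 1 +ᵖ M *ᵖ (const-poly 5 +ᵖ (zerosᵖ +ᵖ const-poly 1)) +ᵖ
      (const-poly 1 +ᵖ M *ᵖ const-poly 3 +ᵖ (const-poly 1 +ᵖ L *ᵖ const-poly 3))))

encoderTime-monoʳ : ∀ L {M N} → M ≤ N → encoderTime L M ≤ encoderTime L N
encoderTime-monoʳ L M≤N = s≤s (*-monoʳ-≤ L (+-monoʳ-≤ 2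
  (+-mono-≤ (s≤s (*-monoˡ-≤ _ M≤N)) (+-monoˡ-≤ (suc (L * 3)) (s≤s (*-monoˡ-≤ 3 M≤N))))))

-- The number of copies depends on X and not on n alone, so the actual time is compared with the
-- time for the largest number of copies that length n allows.
reductionTime-mono : ∀ L {M N} W → M ≤ N → reductionTime L M W ≤ reductionTime L N W
reductionTime-mono L W M≤N =
  +-monoʳ-≤ (suc (L * 5)) (+-monoʳ-≤ (suc (L * 3)) (+-mono-≤ enc≤ (+-monoʳ-≤ (suc (W * 3))
    (+-monoʳ-≤ (suc (L * 3)) (+-monoʳ-≤ (suc (L * 3)) (+-monoˡ-≤ (suc (W * 3)) enc≤))))))
  where enc≤ = encoderTime-monoʳ L M≤N

length-encode-∷ : (s : Fin a) (X : String a) → length (encode (s ∷ X)) ≡ suc (toℕ s) + length (encode X)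
length-encode-∷ s X = trans (length-++ (replicate (toℕ s) 1F ++ [ 0F ]))
  (cong (_+ length (encode X)) (trans (length-++ (replicate (toℕ s) 1F)) (trans (+-comm _ 1) (cong suc (length-replicate (toℕ s))))))

length-encode-≤ : (X : String a) → length (encode X) ≤ length X * a
length-encode-≤ []      = z≤n
length-encode-≤ (s ∷ X) = ≤-trans (≤-reflexive (length-encode-∷ s X)) (+-mono-≤ (F.toℕ<n s) (length-encode-≤ X))

length≤length-encode : (X : String a) → length X ≤ length (encode X)
length≤length-encode []      = z≤n
length≤length-encode (s ∷ X) = ≤-trans (s≤s (≤-trans (length≤length-encode X) (m≤n+m _ (toℕ s))))
  (≤-reflexive (sym (length-encode-∷ s X)))

length-enc-≤ : ∀ M (X : String a) → length (enc M X) ≤ length X * (M * (2 + a))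
length-enc-≤ M []      = z≤n
length-enc-≤ {a} M (s ∷ X) = begin
  length (enc M (s ∷ X))                                               ≡⟨ cong length (concatMap-++ tok (replicate M (toℕ s)) _) ⟩
  length (concatMap tok (replicate M (toℕ s)) ++ enc M X)               ≡⟨ length-++ (concatMap tok (replicate M (toℕ s))) ⟩
  length (concatMap tok (replicate M (toℕ s))) + length (enc M X)       ≤⟨ +-mono-≤ (words M) (length-enc-≤ M X) ⟩
  M * (2 + a) + length X * (M * (2 + a))                               ∎
  where
  open ≤-Reasoning
  length-tok : length (tok (toℕ s)) ≤ 2 + a
  length-tok = s≤s (≤-trans (≤-reflexive (trans (length-++ (replicate (toℕ s) 0F)) (trans (+-comm _ 2) (cong (2 +_) (length-replicate (toℕ s))))))
                            (s≤s (F.toℕ<n s)))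
  words : ∀ M → length (concatMap tok (replicate M (toℕ s))) ≤ M * (2 + a)
  words zero    = z≤n
  words (suc M) = ≤-trans (≤-reflexive (length-++ (tok (toℕ s)))) (+-mono-≤ length-tok (words M))

-- Transfer of distances and the theorem.

as-map-allFin : ∀ {A : Set} (xs : List A) {n} → length xs ≡ n → Σ[ u ∈ (Fin n → A) ] map u (allFin n) ≡ xs
as-map-allFin xs refl = List.lookup xs , trans (map-tabulate id (List.lookup xs)) (tabulate-lookup xs)

enc-reflects-↝ : ∀ {M j} (X Y : String a) → length X ≡ length Y → j < M →
                 Flips j (enc M X) (enc M Y) → X ↝[ j ] Y
enc-reflects-↝ {M = M} {j} X Y len j<M fl with as-map-allFin X len | as-map-allFin Y refl
... | u , X≡ | v , Y≡ = subst₂ (_↝[ j ]_) X≡ Y≡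
  (LowerBound.lower-bound u v j<M (subst₂ (λ X Y → Flips j (enc M X) (enc M Y)) (sym X≡) (sym Y≡) fl))

-- Lifting a shortest sequence gives at most d flips, and minimality makes it exactly d. For
-- minimality a sequence with j < d flips has j < M because d ≤ M, so it yields at most j flips from
-- X to Y, contradicting the choice of d.
enc-IsDistance : ∀ {M d} (X Y : String a) → length X ≡ length Y → d ≤ M → IsDistance X Y d →
                 IsDistance (enc M X) (enc M Y) d
enc-IsDistance {M = M} {d} X Y len d≤M (fl , minimal) =
  subst (λ k → Flips k (enc M X) (enc M Y)) (≤-antisym (proj₁ (proj₂ lifted)) (minimal′ _ fl′)) fl′ , minimal′
  where
  lifted = enc-↝ M fl
  fl′ = proj₂ (proj₂ lifted)
  minimal′ : ∀ j → Flips j (enc M X) (enc M Y) → d ≤ j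
  minimal′ j fl with d ≤? j
  ... | yes d≤j = d≤j
  ... | no  d≰j = let i , i≤j , fl″ = enc-reflects-↝ X Y len (<-≤-trans (≰⇒> d≰j) d≤M) fl in ≤-trans (minimal i fl″) i≤j

theorem6p2 : Σ[ r ∈ ℕ ] Σ[ P ∈ Program (2 + r) ] Σ[ time ∈ (ℕ → ℕ) ] Σ[ size ∈ (ℕ → ℕ) ]
    (PolynomiallyBounded time × PolynomiallyBounded size ×
    ((n : ℕ) (X Y : String n) → length X ≡ n → length Y ≡ n → Compatible X Y →
    Σ[ x ∈ String 2 ] Σ[ y ∈ String 2 ] Σ[ t ∈ ℕ ]
    (Computes P X Y x y t × t ≤ time n ×
    Compatible x y × length x ≤ size n × length y ≤ size n ×
    (∃[ k ] (IsDistance X Y k × IsDistance x y k)))))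
theorem6p2 =
  6 , reduction , timeBound , sizeBound ,
  SucPolynomial⇒PolynomiallyBounded timeBound-poly , SucPolynomial⇒PolynomiallyBounded sizeBound-poly , correct
  where
  correct : (n : ℕ) (X Y : String n) → length X ≡ n → length Y ≡ n → Compatible X Y →
    Σ[ x ∈ String 2 ] Σ[ y ∈ String 2 ] Σ[ t ∈ ℕ ]
    (Computes reduction X Y x y t × t ≤ timeBound n ×
    Compatible x y × length x ≤ sizeBound n × length y ≤ sizeBound n ×
    (∃[ k ] (IsDistance X Y k × IsDistance x y k)))
  correct n X Y lenX lenY comp =
    enc M X , enc M Y , proj₁ run , (_ , proj₂ (proj₂ run)) ,
    ≤-trans (proj₁ (proj₂ run)) (reductionTime-mono (lengthBound n) (sizeBound n) (*-monoˡ-≤ 2 (encode-≤ X lenX))) ,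
    ↭⇒Compatible (Flips-↭ (proj₁ dist)) , enc-≤ X lenX , enc-≤ Y lenY , d , distXY , dist
    where
    M = copies X
    encode-≤ : (Z : String n) → length Z ≡ n → length (encode Z) ≤ lengthBound n
    encode-≤ Z lenZ = subst (λ m → length (encode Z) ≤ m * n) lenZ (length-encode-≤ Z)
    enc-≤ : (Z : String n) → length Z ≡ n → length (enc M Z) ≤ sizeBound n
    enc-≤ Z lenZ = ≤-trans (length-enc-≤ M Z)
      (*-mono-≤ (≤-reflexive lenZ) (*-monoˡ-≤ (2 + n) (*-monoˡ-≤ 2 (encode-≤ X lenX))))
    run = within-reduction X Y (encode-≤ X lenX) (encode-≤ Y lenY) (enc-≤ X lenX) (enc-≤ Y lenY)
    nearest = distance (Compatible⇒↝ X Y comp)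
    d = proj₁ nearest
    distXY = proj₂ (proj₂ nearest)
    d≤M : d ≤ M
    d≤M = begin
      d                  ≤⟨ proj₁ (proj₂ nearest) ⟩
      2 * length Y       ≡⟨ cong (2 *_) (trans lenY (sym lenX)) ⟩
      2 * length X       ≡⟨ *-comm 2 (length X) ⟩
      length X * 2       ≤⟨ *-monoˡ-≤ 2 (length≤length-encode X) ⟩
      M                  ∎
      where open ≤-Reasoning
    dist : IsDistance (enc M X) (enc M Y) d
    dist = enc-IsDistance X Y (trans lenX (sym lenY)) d≤M distXY
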